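{- Let $A$ be a finite subset of a group $G_0$, and let $G=\langle A^{ -1}A\rangle$ be the subgroup of $G_0$ generated by $A^{ -1}A$. Assume that $|A^{ -1}A|\le 2|A|-2$ and $A^{ -1}A\neq G$. Then there are an element $a\in A$ and a non-null subgroup $H$ of $G$ (that is, $H\neq\{1\}$) such that one of the following holds: (i) for all $(x,y)\in (A\times A)\setminus (Ha\times Ha)$ one has $x^{ -1}Hy\subset A^{ -1}A$, and moreover $|A^{ -1}A|>|A^{ -1}H|+|HA|-2|H|$; (ii) for all $(x,y)\in (A\times A)\setminus (aH\times aH)$ one has $xHy^{ -1}\subset AA^{ -1}$, and moreover $|AA^{ -1}|>|AH|+|AH|-2|H|$.
   Context: For subsets $X,Y$ of a group, $XY=\{xy : x\in X,\ y\in Y\}$ is the Minkowski product and $X^{ -1}=\{x^{ -1}: x\in X\}$. -}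

module Defs where

open import Algebra.Bundles using (Group)
open import Data.Fin.Base using (Fin)
open import Data.Nat.Base using (ℕ)
open import Data.Product.Base using (Σ; proj₁; ∃-syntax; _×_)
open import Function.Bundles using (Bijection)
open import Level using (Level; _⊔_)
open import Relation.Binary.Bundles using (Setoid)
open import Relation.Binary.Definitions using (_Respects_)
import Relation.Binary.Construct.On as On
import Relation.Binary.PropositionalEquality.Properties as ≡
open import Relation.Unary using (Pred; _∈_)

private
  variable
    p q : Level

module Subsets {c ℓ} (G₀ : Group c ℓ) where

  open Group G₀

  infixl 7 _·_
  infix  8 _⁻¹ˢ

  _·_ : Pred Carrier p → Pred Carrier q → Pred Carrier (c ⊔ ℓ ⊔ p ⊔ q)
  (X · Y) g = ∃[ x ] ∃[ y ] (x ∈ X × y ∈ Y × g ≈ x ∙ y)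

  _⁻¹ˢ : Pred Carrier p → Pred Carrier (c ⊔ ℓ ⊔ p)
  (X ⁻¹ˢ) g = ∃[ x ] (x ∈ X × g ≈ x ⁻¹)

  -- The singleton up to the group's equality; the library's ｛_｝ uses _≡_.
  ⟦_⟧ : Carrier → Pred Carrier ℓ
  ⟦ a ⟧ g = g ≈ a

  record IsSubgroup (H : Pred Carrier p) : Set (c ⊔ ℓ ⊔ p) where
    field
      resp-≈    : H Respects _≈_
      ε-closed  : ε ∈ H
      ∙-closed  : ∀ {x y} → x ∈ H → y ∈ H → x ∙ y ∈ H
      ⁻¹-closed : ∀ {x} → x ∈ H → x ⁻¹ ∈ H

  -- The subgroup generated by X, as the least predicate with these closure
  -- properties.
  data ⟨_⟩ (X : Pred Carrier p) : Pred Carrier (c ⊔ ℓ ⊔ p) where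
    gen  : ∀ {x} → x ∈ X → x ∈ ⟨ X ⟩
    resp : ∀ {x y} → x ≈ y → x ∈ ⟨ X ⟩ → y ∈ ⟨ X ⟩
    unit : ε ∈ ⟨ X ⟩
    mul  : ∀ {x y} → x ∈ ⟨ X ⟩ → y ∈ ⟨ X ⟩ → x ∙ y ∈ ⟨ X ⟩
    inv  : ∀ {x} → x ∈ ⟨ X ⟩ → x ⁻¹ ∈ ⟨ X ⟩

  -- The elements of P, with two of them identified when they are equal in G₀
  -- (the membership proofs are disregarded).
  elements : Pred Carrier p → Setoid (c ⊔ p) ℓ
  elements P = On.setoid {B = Σ Carrier P} setoid proj₁

  -- "P is finite and has exactly n elements".
  ∣_∣≡_ : Pred Carrier p → ℕ → Set (c ⊔ ℓ ⊔ p)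
  ∣ P ∣≡ n = Bijection (≡.setoid (Fin n)) (elements P)

{-# OPTIONS --safe #-}
module Submission where

-- Write Q = A⁻¹A. The heart of the matter is an inequality of Kneser type: Q is
-- stable under a finite subgroup L with |L| ≥ 2|A| − |Q| ≥ 2. Consider pairs
-- (S , E) with S⁻¹E ⊆ Q, of weight |S| + |E|; the pairs (a⁻¹A , a⁻¹A) have weight
-- 2|A| and reach every element of Q. Replacing two pairs by
-- (S ∩ S′ , E ∪ E′) and (S ∪ S′ , E ∩ E′) preserves the total weight, so a heaviest
-- pair with S minimal is (K₁ , E₁) with K₁ a subgroup and E₁ = K₁E₁K₁ = E₁⁻¹. The
-- pairs then descend to pairs with S ⊆ K₁ for the remaining set Q ∖ E₁, and one
-- repeats until Q is exhausted; the last subgroup stabilises Q.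
--
-- Let T be the stabiliser of Q. The inequality for AT gives |AT| ≤ |A| + |T| − 2.
-- Hence a finite Y ⊆ ⟨Q⟩ minimising |AY| − |Y|, and then |Y|, is up to translation
-- a nontrivial subgroup H with |AH| − |H| ≤ |A| − 2. By minimality
-- |AA⁻¹| − |A| ≥ |AH| − |H|, and since A misses at most |H| − 2 elements of AH the
-- pigeonhole principle gives xHy⁻¹ ⊆ AA⁻¹. So the second alternative always holds.

open import Algebra.Bundles using (Group)
import Algebra.Properties.Group as GroupProperties
open import Axiom.ExcludedMiddle using (ExcludedMiddle)
open import Data.Fin.Base using (zero; suc)
open import Data.Fin.Properties using (injective⇒≤)
open import Data.List.Base using (List; []; _∷_; _++_; map; filter; length; lookup; tabulate)
open import Data.List.Properties using (length-map; length-++; length-tabulate)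
import Data.List.Membership.Setoid as Membership
open import Data.List.Membership.Setoid.Properties
  using (∈-resp-≈; ∈-map⁺; ∈-map⁻; ∈-++⁺ˡ; ∈-++⁺ʳ; ∈-++⁻; ∈-filter⁺; ∈-filter⁻;
         ∈-tabulate⁺; ∈-tabulate⁻; ∈-lookup; index-injective)
open import Data.List.Relation.Unary.All using ([])
open import Data.List.Relation.Unary.AllPairs using ([]; _∷_)
open import Data.List.Relation.Unary.Any as Any using (Any; here; there; index)
open import Data.List.Relation.Unary.Any.Properties using (lookup-index)
import Data.List.Relation.Unary.Unique.Setoid as Uniqueness
import Data.List.Relation.Unary.Unique.Setoid.Properties as Uniqueₚ
open import Data.Nat.Base using (ℕ; zero; suc)
import Data.Nat.Base as ℕ
open import Data.Nat.Induction using (<-wellFounded; Acc; acc)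
import Data.Nat.Properties as ℕₚ
open import Data.Nat.Tactic.RingSolver using (solve-∀)
open import Data.Product.Base using (Σ-syntax; ∃-syntax; _×_; _,_; proj₁; proj₂)
open import Data.Sum.Base using (_⊎_; inj₁; inj₂; [_,_]; [_,_]′)
open import Data.Unit.Base using (⊤)
open import Function.Base using (_∘_)
open import Function.Bundles using (Bijection)
open import Level using (Level; _⊔_; Lift; lift; lower)
open import Relation.Binary.Bundles using (Setoid)
open import Relation.Binary.Definitions using (_Respects_)
open import Relation.Binary.PropositionalEquality as ≡ using (_≡_)
open import Relation.Nullary.Decidable using (Dec; yes; no; map′; decidable-stable)
open import Relation.Nullary.Negation.Core using (¬_; contradiction)
open import Relation.Unary using (Pred)
open import Defs

private variable
  α β : Level

lowerEM : ExcludedMiddle (α ⊔ β) → ExcludedMiddle α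
lowerEM {β = β} em = map′ lower (lift {ℓ = β}) em

-- Extremal elements and certificates for linear inequalities.

module NaturalArguments where

  open import Data.Nat.Base using (_+_; _∸_; _≤_; _<_; z≤n; s≤s)
  open import Data.Nat.Properties

  abstract

    argmin : ExcludedMiddle α → {X : Set α} (f : X → ℕ) → X → Σ[ x ∈ X ] ∀ y → f x ≤ f y
    argmin em {X} f x₀ = go x₀ (<-wellFounded (f x₀))
      where
      go : ∀ x → Acc _<_ (f x) → Σ[ x ∈ X ] ∀ y → f x ≤ f y
      go x (acc rec) with em {Σ[ y ∈ X ] f y < f x}
      ... | yes (y , y<x) = go y (rec y<x)
      ... | no  minimal   = x , λ y → ≮⇒≥ (λ y<x → minimal (y , y<x))

    argmax : ExcludedMiddle α → {X : Set α} (f : X → ℕ) {b : ℕ} → (∀ x → f x ≤ b) → X → Σ[ x ∈ X ] ∀ y → f y ≤ f x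
    argmax em f {b} bounded x₀ with argmin em (λ x → b ∸ f x) x₀
    ... | x , minimal = x , λ y → ≮⇒≥ λ x<y → <⇒≱ (∸-monoʳ-< x<y (bounded y)) (minimal y)

  -- Linear arithmetic: L ≤ R is a sum of hypotheses, s the slack, and the equation is
  -- a ring identity.
  linear : ∀ {x y L R} s → L ≤ R → x + R + s ≡ y + L → x ≤ y
  linear {x} {y} {L} {R} s L≤R eq = +-cancelʳ-≤ R x y (begin
    x + R     ≤⟨ m≤m+n (x + R) s ⟩
    x + R + s ≡⟨ eq ⟩
    y + L     ≤⟨ +-monoʳ-≤ y L≤R ⟩
    y + R     ∎)
    where open ≤-Reasoning

  -- The same kind of certificate for hypotheses whose sum is contradictory: `L` exceeds `R` by
  -- `1 + s`.
  impossible : ∀ {w} {W : Set w} {L R} s → L ≤ R → 1 + R + s ≡ L → W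
  impossible {L = L} {R} s L≤R eq = contradiction (≤-trans (≤-reflexive eq) L≤R) (<⇒≱ (m≤m+n (1 + R) s))

  infixr 5 _⊕_
  _⊕_ : ∀ {x y u v} → x ≤ y → u ≤ v → x + u ≤ y + v
  _⊕_ = +-mono-≤

open NaturalArguments

-- Finite sets

module FiniteSets {c ℓ} (S : Setoid c ℓ) (em : ExcludedMiddle (c ⊔ ℓ)) where

  open import Data.Nat.Base using (_+_; _∸_; _≤_; _<_; z≤n; s≤s)
  open import Data.Nat.Properties
  open Setoid S
  open Membership S using () renaming (_∈_ to _∈ₗ_)
  open Uniqueness S using (Unique)

  record FinSet : Set (c ⊔ ℓ) where
    constructor finSet
    field
      list   : List Carrier
      unique : Unique list

  open FinSet public

  infix 4 _∈_ _∉_ _⊆_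
  infix 8 #_
  infixr 7 _∩_
  infixr 6 _∪_ _∖_

  _∈_ _∉_ : Carrier → FinSet → Set (c ⊔ ℓ)
  x ∈ X = x ∈ₗ list X
  x ∉ X = ¬ (x ∈ X)

  _⊆_ : FinSet → FinSet → Set (c ⊔ ℓ)
  X ⊆ Y = ∀ {x} → x ∈ X → x ∈ Y

  Inhabited : FinSet → Set (c ⊔ ℓ)
  Inhabited X = ∃[ x ] x ∈ X

  #_ : FinSet → ℕ
  # X = length (list X)

  ∈-resp : ∀ X {x y} → x ≈ y → x ∈ X → y ∈ X
  ∈-resp X = ∈-resp-≈ S

  abstract

    lookup-injective : ∀ {xs} → Unique xs → ∀ i j → lookup xs i ≈ lookup xs j → i ≡ j
    lookup-injective u@(_ ∷ _) zero zero _ = ≡.refl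
    lookup-injective {_ ∷ xs} u@(_ ∷ _) zero (suc j) eq =
      contradiction (∈-resp-≈ S (sym eq) (∈-lookup S xs j)) (Uniqueₚ.Unique[x∷xs]⇒x∉xs S u)
    lookup-injective {_ ∷ xs} u@(_ ∷ _) (suc i) zero eq =
      contradiction (∈-resp-≈ S eq (∈-lookup S xs i)) (Uniqueₚ.Unique[x∷xs]⇒x∉xs S u)
    lookup-injective (_ ∷ u) (suc i) (suc j) eq = ≡.cong suc (lookup-injective u i j eq)

    injection⇒≤ : ∀ X Y (φ : Carrier → Carrier) → (∀ {x} → x ∈ X → φ x ∈ Y) →
                  (∀ {x y} → φ x ≈ φ y → x ≈ y) → # X ≤ # Y
    injection⇒≤ X Y φ φ∈ φ-inj = injective⇒≤ {f = λ i → index (φ∈ (∈-lookup S (list X) i))} λ {i} {j} eq →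
      lookup-injective (unique X) i j (φ-inj (index-injective S (φ∈ (∈-lookup S _ i)) (φ∈ (∈-lookup S _ j)) eq))

    ⊆⇒≤ : ∀ X Y → X ⊆ Y → # X ≤ # Y
    ⊆⇒≤ X Y X⊆Y = injection⇒≤ X Y (λ x → x) X⊆Y (λ x≈y → x≈y)

  abstract

    ⟨_∣_⟩ : FinSet → Pred Carrier (c ⊔ ℓ) → FinSet
    ⟨ X ∣ P ⟩ = finSet (filter (λ x → em {P x}) (list X)) (Uniqueₚ.filter⁺ S (λ x → em {P x}) (unique X))

    sift⁺ : ∀ X {P} → P Respects _≈_ → ∀ {x} → x ∈ X → P x → x ∈ ⟨ X ∣ P ⟩
    sift⁺ X {P} resp = ∈-filter⁺ S (λ x → em {P x}) resp

    sift⁻ : ∀ X {P} → P Respects _≈_ → ∀ {x} → x ∈ ⟨ X ∣ P ⟩ → x ∈ X × P x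
    sift⁻ X {P} resp = ∈-filter⁻ S (λ x → em {P x}) resp {xs = list X}

    ¬-resp : {P : Pred Carrier (c ⊔ ℓ)} → P Respects _≈_ → (λ x → ¬ P x) Respects _≈_
    ¬-resp resp x≈y ¬Px Py = ¬Px (resp (sym x≈y) Py)

    #sift : ∀ X P → # ⟨ X ∣ P ⟩ + # ⟨ X ∣ (λ x → ¬ P x) ⟩ ≡ # X
    #sift X P = go (list X)
      where
      go : ∀ xs → length (filter (λ x → em {P x}) xs) + length (filter (λ x → em {¬ P x}) xs) ≡ length xs
      go [] = ≡.refl
      go (x ∷ xs) with em {P x} | em {¬ P x}
      ... | yes _ | no _   = ≡.cong suc (go xs)
      ... | no _  | yes _  = ≡.trans (+-suc _ _) (≡.cong suc (go xs))
      ... | yes p | yes ¬p = contradiction p ¬p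
      ... | no ¬p | no ¬¬p = contradiction ¬p ¬¬p

    _∩_ _∖_ _∪_ : FinSet → FinSet → FinSet
    X ∩ Y = ⟨ X ∣ _∈ Y ⟩
    X ∖ Y = ⟨ X ∣ _∉ Y ⟩
    X ∪ Y = finSet (list X ++ list (Y ∖ X)) (Uniqueₚ.++⁺ S (unique X) (unique (Y ∖ X))
      λ (v∈X , v∈Y∖X) → proj₂ (sift⁻ Y (¬-resp (∈-resp X)) v∈Y∖X) v∈X)

    ∩⁺ : ∀ X Y {x} → x ∈ X → x ∈ Y → x ∈ X ∩ Y
    ∩⁺ X Y = sift⁺ X (∈-resp Y)

    ∩⁻ : ∀ X Y {x} → x ∈ X ∩ Y → x ∈ X × x ∈ Y
    ∩⁻ X Y = sift⁻ X (∈-resp Y)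

    ∖⁺ : ∀ X Y {x} → x ∈ X → x ∉ Y → x ∈ X ∖ Y
    ∖⁺ X Y = sift⁺ X (¬-resp (∈-resp Y))

    ∖⁻ : ∀ X Y {x} → x ∈ X ∖ Y → x ∈ X × x ∉ Y
    ∖⁻ X Y = sift⁻ X (¬-resp (∈-resp Y))

    ∪⁺ˡ : ∀ X Y {x} → x ∈ X → x ∈ X ∪ Y
    ∪⁺ˡ X Y = ∈-++⁺ˡ S

    ∪⁺ʳ : ∀ X Y {x} → x ∈ Y → x ∈ X ∪ Y
    ∪⁺ʳ X Y {x} x∈Y with em {x ∈ X}
    ... | yes x∈X = ∪⁺ˡ X Y x∈X
    ... | no  x∉X = ∈-++⁺ʳ S (list X) (∖⁺ Y X x∈Y x∉X)

    ∪⁻ : ∀ X Y {x} → x ∈ X ∪ Y → x ∈ X ⊎ x ∈ Y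
    ∪⁻ X Y x∈ with ∈-++⁻ S (list X) x∈
    ... | inj₁ x∈X = inj₁ x∈X
    ... | inj₂ x∈Y = inj₂ (proj₁ (∖⁻ Y X x∈Y))

    #∪ : ∀ X Y → # (X ∪ Y) ≡ # X + # (Y ∖ X)
    #∪ X Y = length-++ (list X)

    #∩+#∖ : ∀ X Y → # (X ∩ Y) + # (X ∖ Y) ≡ # X
    #∩+#∖ X Y = #sift X (_∈ Y)

    #∩-comm : ∀ X Y → # (X ∩ Y) ≡ # (Y ∩ X)
    #∩-comm X Y = ≤-antisym (swap X Y) (swap Y X)
      where
      swap : ∀ X Y → # (X ∩ Y) ≤ # (Y ∩ X)
      swap X Y = ⊆⇒≤ (X ∩ Y) (Y ∩ X) λ x∈ → ∩⁺ Y X (proj₂ (∩⁻ X Y x∈)) (proj₁ (∩⁻ X Y x∈))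

    #∩+#∪ : ∀ X Y → # (X ∩ Y) + # (X ∪ Y) ≡ # X + # Y
    #∩+#∪ X Y = begin
      # (X ∩ Y) + # (X ∪ Y)             ≡⟨ ≡.cong₂ _+_ (#∩-comm X Y) (#∪ X Y) ⟩
      # (Y ∩ X) + (# X + # (Y ∖ X))   ≡⟨ lemma (# (Y ∩ X)) (# X) (# (Y ∖ X)) ⟩
      # X + (# (Y ∩ X) + # (Y ∖ X))   ≡⟨ ≡.cong (# X +_) (#∩+#∖ Y X) ⟩
      # X + # Y                     ∎
      where
      open ≡.≡-Reasoning
      lemma : ∀ i x d → i + (x + d) ≡ x + (i + d)
      lemma = solve-∀

  abstract

    inhabited⇒1≤ : ∀ X → Inhabited X → 1 ≤ # X
    inhabited⇒1≤ (finSet (_ ∷ _) _) _ = s≤s z≤n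

    1≤⇒inhabited : ∀ X → 1 ≤ # X → Inhabited X
    1≤⇒inhabited (finSet (x ∷ _) _) _ = x , here refl

    ⊆∧≥⇒⊇ : ∀ X Y → X ⊆ Y → # Y ≤ # X → Y ⊆ X
    ⊆∧≥⇒⊇ X Y X⊆Y #Y≤#X {y} y∈Y with em {y ∈ X}
    ... | yes y∈X = y∈X
    ... | no  y∉X = contradiction (begin
      1 + # X               ≤⟨ +-mono-≤ (inhabited⇒1≤ (Y ∖ X) (y , ∖⁺ Y X y∈Y y∉X))
                                          (⊆⇒≤ X (Y ∩ X) λ x∈X → ∩⁺ Y X (X⊆Y x∈X) x∈X) ⟩
      # (Y ∖ X) + # (Y ∩ X)   ≡⟨ +-comm (# (Y ∖ X)) _ ⟩
      # (Y ∩ X) + # (Y ∖ X)   ≡⟨ #∩+#∖ Y X ⟩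
      # Y                   ≤⟨ #Y≤#X ⟩
      # X                   ∎) 1+n≰n
      where open ≤-Reasoning

    pigeonhole : ∀ X Y Z → X ⊆ Z → Y ⊆ Z → # Z < # X + # Y → Inhabited (X ∩ Y)
    pigeonhole X Y Z X⊆Z Y⊆Z #Z< = 1≤⇒inhabited (X ∩ Y) (linear 0 (≤-trans (+-mono-≤ #Z< #X∪Y≤)
        (≤-reflexive (≡.cong (_+ # Z) (≡.sym (#∩+#∪ X Y))))) (lemma (# Z) (# (X ∩ Y)) (# (X ∪ Y))))
      where
      #X∪Y≤ : # (X ∪ Y) ≤ # Z
      #X∪Y≤ = ⊆⇒≤ (X ∪ Y) Z λ x∈ → [ X⊆Z , Y⊆Z ] (∪⁻ X Y x∈)
      lemma : ∀ z i u → 1 + (i + u + z) + 0 ≡ i + (suc z + u)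
      lemma = solve-∀

  ｛_｝ : Carrier → FinSet
  ｛ x ｝ = finSet (x ∷ []) ([] ∷ [])

  Injection : (Carrier → Carrier) → Set (c ⊔ ℓ)
  Injection φ = (∀ {x y} → x ≈ y → φ x ≈ φ y) × (∀ {x y} → φ x ≈ φ y → x ≈ y)

  abstract

    image : ∀ φ → Injection φ → FinSet → FinSet
    image φ (_ , inj) X = finSet (map φ (list X)) (Uniqueₚ.map⁺ S S inj (unique X))

    image⁺ : ∀ φ inj X {x} → x ∈ X → φ x ∈ image φ inj X
    image⁺ φ (cong , _) X x∈ = ∈-map⁺ S S cong x∈

    image⁻ : ∀ φ inj X {y} → y ∈ image φ inj X → ∃[ x ] x ∈ X × y ≈ φ x
    image⁻ φ inj X = ∈-map⁻ S S

    #image : ∀ φ inj X → # (image φ inj X) ≡ # X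
    #image φ inj X = length-map φ (list X)

-- Translates and inverses of finite subsets of a group.

module FiniteSubsets {c ℓ} (G₀ : Group c ℓ) (em : ExcludedMiddle (c ⊔ ℓ)) where

  open import Data.Nat.Base using (_+_; _∸_; _≤_; _<_; z≤n; s≤s)
  open import Data.Nat.Properties
  open Group G₀ hiding (_-_)
  open GroupProperties G₀
  open Subsets G₀ using (IsSubgroup)
  open IsSubgroup
  open FiniteSets setoid em public
  open import Relation.Binary.Reasoning.Setoid setoid

  cancelˡ : ∀ k x → k ⁻¹ ∙ (k ∙ x) ≈ x
  cancelˡ = \\-leftDividesʳ

  cancelˡ⁻¹ : ∀ k x → k ∙ (k ⁻¹ ∙ x) ≈ x
  cancelˡ⁻¹ = \\-leftDividesˡ

  ⁻¹-quotient : ∀ x y → (x ⁻¹ ∙ y) ⁻¹ ≈ y ⁻¹ ∙ x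
  ⁻¹-quotient = ⁻¹-anti-homo-\\

  quotient-trans : ∀ x y z → (x ⁻¹ ∙ y) ∙ (y ⁻¹ ∙ z) ≈ x ⁻¹ ∙ z
  quotient-trans x y z = trans (assoc _ _ _) (∙-congˡ (cancelˡ⁻¹ y z))

  quotient-shift : ∀ k x y → (k ∙ x) ⁻¹ ∙ (k ∙ y) ≈ x ⁻¹ ∙ y
  quotient-shift k x y = begin
    (k ∙ x) ⁻¹ ∙ (k ∙ y)     ≈⟨ ∙-congʳ (⁻¹-anti-homo-∙ k x) ⟩
    x ⁻¹ ∙ k ⁻¹ ∙ (k ∙ y)    ≈⟨ assoc _ _ _ ⟩
    x ⁻¹ ∙ (k ⁻¹ ∙ (k ∙ y))  ≈⟨ ∙-congˡ (cancelˡ k y) ⟩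
    x ⁻¹ ∙ y                 ∎

  ε⁻¹∙ : ∀ x → ε ⁻¹ ∙ x ≈ x
  ε⁻¹∙ x = trans (∙-congʳ ε⁻¹≈ε) (identityˡ x)

  infixr 7.5 _◃_
  infixl 7.5 _▹_ _◂_

  ∙ˡ-injection : ∀ k → Injection (k ∙_)
  ∙ˡ-injection k = ∙-congˡ , ∙-cancelˡ k _ _

  ∙ʳ-injection : ∀ k → Injection (_∙ k)
  ∙ʳ-injection k = ∙-congʳ , ∙-cancelʳ k _ _

  ⁻¹∙-injection : ∀ k → Injection (λ x → x ⁻¹ ∙ k)
  ⁻¹∙-injection k = ∙-congʳ ∘ ⁻¹-cong , ⁻¹-injective ∘ ∙-cancelʳ k _ _

  _◃_ : Carrier → FinSet → FinSet
  k ◃ X = image (k ∙_) (∙ˡ-injection k) X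

  _▹_ : FinSet → Carrier → FinSet
  X ▹ k = image (_∙ k) (∙ʳ-injection k) X

  _◂_ : FinSet → Carrier → FinSet
  X ◂ k = image (λ x → x ⁻¹ ∙ k) (⁻¹∙-injection k) X

  #◃ : ∀ k X → # (k ◃ X) ≡ # X
  #◃ k = #image (k ∙_) (∙ˡ-injection k)

  #▹ : ∀ X k → # (X ▹ k) ≡ # X
  #▹ X k = #image (_∙ k) (∙ʳ-injection k) X

  #◂ : ∀ X k → # (X ◂ k) ≡ # X
  #◂ X k = #image (λ x → x ⁻¹ ∙ k) (⁻¹∙-injection k) X

  ◃⁺ : ∀ k X {x} → x ∈ X → k ∙ x ∈ k ◃ X
  ◃⁺ k = image⁺ (k ∙_) (∙ˡ-injection k)

  ◃⁺⁻¹ : ∀ k X {x} → k ⁻¹ ∙ x ∈ X → x ∈ k ◃ X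
  ◃⁺⁻¹ k X {x} x∈ = ∈-resp (k ◃ X) (cancelˡ⁻¹ k x) (◃⁺ k X x∈)

  ◃⁻ : ∀ k X {x} → x ∈ k ◃ X → k ⁻¹ ∙ x ∈ X
  ◃⁻ k X x∈ with image⁻ (k ∙_) (∙ˡ-injection k) X x∈
  ... | y , y∈X , x≈ky = ∈-resp X (sym (trans (∙-congˡ x≈ky) (cancelˡ k y))) y∈X

  ▹⁺ : ∀ X k {x} → x ∈ X → x ∙ k ∈ X ▹ k
  ▹⁺ X k = image⁺ (_∙ k) (∙ʳ-injection k) X

  ▹⁻ : ∀ X k {x} → x ∈ X ▹ k → ∃[ y ] y ∈ X × x ≈ y ∙ k
  ▹⁻ X k = image⁻ (_∙ k) (∙ʳ-injection k) X

  ◂⁺ : ∀ X k {x} → x ∈ X → x ⁻¹ ∙ k ∈ X ◂ k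
  ◂⁺ X k = image⁺ (λ x → x ⁻¹ ∙ k) (⁻¹∙-injection k) X

  ◂⁻ : ∀ X k {x} → x ∈ X ◂ k → ∃[ y ] y ∈ X × x ≈ y ⁻¹ ∙ k
  ◂⁻ X k = image⁻ (λ x → x ⁻¹ ∙ k) (⁻¹∙-injection k) X

  Symmetric : FinSet → Set (c ⊔ ℓ)
  Symmetric X = ∀ {x} → x ∈ X → x ⁻¹ ∈ X

  quotient-swap : ∀ X → Symmetric X → ∀ {x y} → x ⁻¹ ∙ y ∈ X → y ⁻¹ ∙ x ∈ X
  quotient-swap X X⁻¹ x⁻¹y∈ = ∈-resp X (⁻¹-quotient _ _) (X⁻¹ x⁻¹y∈)

  -- Heavy pairs

  module Pairs (K : Pred Carrier (c ⊔ ℓ)) (K≤ : IsSubgroup K) (F : FinSet) where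

    -- The restriction of `S` to `K` is vacuous at the start. After a step of the descent `K` is the
    -- subgroup just found, so whatever is found next lies inside it and preserves the part of `F`
    -- already treated.
    record Pair : Set (c ⊔ ℓ) where
      field
        S E      : FinSet
        S⊆K      : ∀ {x} → x ∈ S → K x
        S≠∅      : Inhabited S
        E≠∅      : Inhabited E
        quotient : ∀ {s e} → s ∈ S → e ∈ E → s ⁻¹ ∙ e ∈ F

    open Pair public

    weight : Pair → ℕ
    weight P = # (S P) + # (E P)

    #E≤#F : ∀ P → # (E P) ≤ # F
    #E≤#F P = let s , s∈ = S≠∅ P in
      injection⇒≤ (E P) F (s ⁻¹ ∙_) (quotient P s∈) (∙-cancelˡ (s ⁻¹) _ _)

    #S≤ : ∀ P X {e} → (∀ {s} → s ∈ S P → s ⁻¹ ∙ e ∈ X) → # (S P) ≤ # X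
    #S≤ P X {e} ⊆X = injection⇒≤ (S P) X (λ s → s ⁻¹ ∙ e) ⊆X (⁻¹-injective ∘ ∙-cancelʳ e _ _)

    #S≤#F : ∀ P → # (S P) ≤ # F
    #S≤#F P = let e , e∈ = E≠∅ P in #S≤ P F (λ s∈ → quotient P s∈ e∈)

    translate : ∀ k → K k → Pair → Pair
    translate k k∈K P = record
      { S        = k ◃ S P
      ; E        = k ◃ E P
      ; S⊆K      = λ x∈ → resp-≈ K≤ (cancelˡ⁻¹ k _) (∙-closed K≤ k∈K (S⊆K P (◃⁻ k (S P) x∈)))
      ; S≠∅      = let _ , s∈ = S≠∅ P in _ , ◃⁺ k (S P) s∈
      ; E≠∅      = let _ , e∈ = E≠∅ P in _ , ◃⁺ k (E P) e∈
      ; quotient = λ s∈ e∈ → ∈-resp F (quotient-shift (k ⁻¹) _ _) (quotient P (◃⁻ k (S P) s∈) (◃⁻ k (E P) e∈))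
      }

    weight-translate : ∀ k k∈K P → weight (translate k k∈K P) ≡ weight P
    weight-translate k k∈K P = ≡.cong₂ _+_ (#◃ k (S P)) (#◃ k (E P))

    module _ (P Q : Pair) (S∩S≠∅ : Inhabited (S P ∩ S Q)) (E∩E≠∅ : Inhabited (E P ∩ E Q)) where

      meet join : Pair
      meet = record
        { S        = S P ∩ S Q
        ; E        = E P ∪ E Q
        ; S⊆K      = λ x∈ → S⊆K P (proj₁ (∩⁻ (S P) (S Q) x∈))
        ; S≠∅      = S∩S≠∅
        ; E≠∅      = let _ , e∈ = E≠∅ P in _ , ∪⁺ˡ (E P) (E Q) e∈
        ; quotient = λ s∈ e∈ → let s∈P , s∈Q = ∩⁻ (S P) (S Q) s∈ in
            [ quotient P s∈P , quotient Q s∈Q ] (∪⁻ (E P) (E Q) e∈)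
        }
      join = record
        { S        = S P ∪ S Q
        ; E        = E P ∩ E Q
        ; S⊆K      = λ x∈ → [ S⊆K P , S⊆K Q ] (∪⁻ (S P) (S Q) x∈)
        ; S≠∅      = let _ , s∈ = S≠∅ P in _ , ∪⁺ˡ (S P) (S Q) s∈
        ; E≠∅      = E∩E≠∅
        ; quotient = λ s∈ e∈ → let e∈P , e∈Q = ∩⁻ (E P) (E Q) e∈ in
            [ (λ s∈P → quotient P s∈P e∈P) , (λ s∈Q → quotient Q s∈Q e∈Q) ] (∪⁻ (S P) (S Q) s∈)
        }

      weight-modular : weight meet + weight join ≡ weight P + weight Q
      weight-modular = ≡.trans (interchange (# (S P ∩ S Q)) _ _ _)
        (≡.trans (≡.cong₂ _+_ (#∩+#∪ (S P) (S Q))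
                              (≡.trans (+-comm (# (E P ∪ E Q)) _) (#∩+#∪ (E P) (E Q))))
                 (interchange (# (S P)) _ _ _))
        where
        interchange : ∀ a b c d → (a + b) + (c + d) ≡ (a + c) + (b + d)
        interchange = solve-∀
    weight-bounded : ∀ P → weight P ≤ # F + # F
    weight-bounded P = +-mono-≤ (#S≤#F P) (#E≤#F P)

    Cover : ℕ → Carrier → Set (c ⊔ ℓ)
    Cover t f = Σ[ P ∈ Pair ] (ε ∈ S P × f ∈ E P) × t ≤ weight P

    -- The inverse is allowed because one case of the descent exchanges the two components of a pair
    -- and so replaces `f` by `f ⁻¹`.
    Covered : ℕ → Set (c ⊔ ℓ)
    Covered κ = ∀ {f} → f ∈ F → Cover (# F + κ) f ⊎ Cover (# F + κ) (f ⁻¹)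

    -- Exchange arguments for pairs of greatest weight.

    module Heaviest (F⁻¹ : Symmetric F) (maximum : ℕ) (≤maximum : ∀ P → weight P ≤ maximum)
                    (#F<maximum : # F < maximum) where

      Heavy : Set (c ⊔ ℓ)
      Heavy = Σ[ P ∈ Pair ] maximum ≤ weight P

      #F<heavy : ((P , _) : Heavy) → # F < weight P
      #F<heavy (P , w≤) = ≤-trans #F<maximum w≤

      -- The meet and the join together weigh at least `maximum + maximum`, of which the join takes
      -- at most `maximum`.
      meet-heavy : ∀ ((P , _) (Q , _) : Heavy) S∩ E∩ → maximum ≤ weight (meet P Q S∩ E∩)
      meet-heavy (P , w≤P) (Q , w≤Q) S∩ E∩ = linear 0
        ((w≤P ⊕ w≤Q) ⊕ ≤maximum (join P Q S∩ E∩) ⊕ ≤-reflexive (≡.sym (weight-modular P Q S∩ E∩)))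
        (lemma maximum (weight P) (weight Q) (weight (meet P Q S∩ E∩)) (weight (join P Q S∩ E∩)))
        where
        lemma : ∀ w p q m j → w + ((p + q) + (w + (m + j))) + 0 ≡ m + ((w + w) + (j + (p + q)))
        lemma = solve-∀

      join-heavy : ∀ ((P , _) (Q , _) : Heavy) S∩ E∩ → maximum ≤ weight (join P Q S∩ E∩)
      join-heavy (P , w≤P) (Q , w≤Q) S∩ E∩ = linear 0
        ((w≤P ⊕ w≤Q) ⊕ ≤maximum (meet P Q S∩ E∩) ⊕ ≤-reflexive (≡.sym (weight-modular P Q S∩ E∩)))
        (lemma maximum (weight P) (weight Q) (weight (meet P Q S∩ E∩)) (weight (join P Q S∩ E∩)))
        where
        lemma : ∀ w p q m j → w + ((p + q) + (w + (m + j))) + 0 ≡ j + ((w + w) + (m + (p + q)))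
        lemma = solve-∀

      translate-heavy : ∀ k → K k → Heavy → Heavy
      translate-heavy k k∈K (P , w≤) =
        translate k k∈K P , ≤-trans w≤ (≤-reflexive (≡.sym (weight-translate k k∈K P)))

      -- Adjoining `t` to `S` would give a pair of weight above `maximum`.
      S-saturated : ((P , _) : Heavy) → ∀ {t} → K t → (∀ {e} → e ∈ E P → t ⁻¹ ∙ e ∈ F) → t ∈ S P
      S-saturated (P , w≤) {t} t∈K t⁻¹E⊆F with em {t ∈ S P}
      ... | yes t∈S = t∈S
      ... | no  t∉S = impossible 0
        (w≤ ⊕ ≤maximum larger ⊕ ≤-reflexive (≡.sym (#∪ (S P) ｛ t ｝))
          ⊕ inhabited⇒1≤ (｛ t ｝ ∖ S P) (t , ∖⁺ ｛ t ｝ (S P) (here refl) t∉S))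
        (lemma (# (S P ∪ ｛ t ｝)) (# (E P)) maximum (# (S P)) (# (｛ t ｝ ∖ S P)))
        where
        larger : Pair
        larger = record
          { S = S P ∪ ｛ t ｝ ; E = E P
          ; S⊆K = λ x∈ → [ S⊆K P , (λ { (here x≈t) → resp-≈ K≤ (sym x≈t) t∈K }) ] (∪⁻ (S P) ｛ t ｝ x∈)
          ; S≠∅ = t , ∪⁺ʳ (S P) ｛ t ｝ (here refl)
          ; E≠∅ = E≠∅ P
          ; quotient = λ s∈ e∈ → [ (λ s∈S → quotient P s∈S e∈)
                                 , (λ { (here x≈t) → ∈-resp F (∙-congʳ (⁻¹-cong (sym x≈t))) (t⁻¹E⊆F e∈) }) ]
                                 (∪⁻ (S P) ｛ t ｝ s∈)
          }
        lemma : ∀ u e w s d → 1 + ((s + e) + (w + (u + d))) + 0 ≡ w + ((u + e) + ((s + d) + 1))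
        lemma = solve-∀

      E-saturated : ((P , _) : Heavy) → ∀ {t} → (∀ {s} → s ∈ S P → s ⁻¹ ∙ t ∈ F) → t ∈ E P
      E-saturated (P , w≤) {t} S⁻¹t⊆F with em {t ∈ E P}
      ... | yes t∈E = t∈E
      ... | no  t∉E = impossible 0
        (w≤ ⊕ ≤maximum larger ⊕ ≤-reflexive (≡.sym (#∪ (E P) ｛ t ｝))
          ⊕ inhabited⇒1≤ (｛ t ｝ ∖ E P) (t , ∖⁺ ｛ t ｝ (E P) (here refl) t∉E))
        (lemma (# (E P ∪ ｛ t ｝)) (# (S P)) maximum (# (E P)) (# (｛ t ｝ ∖ E P)))
        where
        larger : Pair
        larger = record
          { S = S P ; E = E P ∪ ｛ t ｝
          ; S⊆K = S⊆K P
          ; S≠∅ = S≠∅ P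
          ; E≠∅ = t , ∪⁺ʳ (E P) ｛ t ｝ (here refl)
          ; quotient = λ s∈ e∈ → [ quotient P s∈ , (λ { (here x≈t) → ∈-resp F (∙-congˡ (sym x≈t)) (S⁻¹t⊆F s∈) }) ]
                                 (∪⁻ (E P) ｛ t ｝ e∈)
          }
        lemma : ∀ u s w e d → 1 + ((s + e) + (w + (u + d))) + 0 ≡ w + ((s + u) + ((e + d) + 1))
        lemma = solve-∀

      -- Take E = B as small as possible. It is a coset K′q of a subgroup K′ of K, and
      -- S = T satisfies K′T = T, |T| ≥ 2|K′|. Since |F| < |T| + |B|, the sets T⁻¹q and
      -- q⁻¹T overlap so much in F that q⁻¹K′q ⊆ K. So (q⁻¹B , q⁻¹T) is a heavy pair
      -- with |S| < |E|.
      module AllTall (tall : ((P , _) : Heavy) → # (E P) < # (S P)) (P̂ : Heavy)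
                     (shortest : ∀ ((Q , _) : Heavy) → # (E (proj₁ P̂)) ≤ # (E Q)) where

        T B : FinSet
        T = S (proj₁ P̂)
        B = E (proj₁ P̂)

        q : Carrier
        q = proj₁ (E≠∅ (proj₁ P̂))

        q∈B : q ∈ B
        q∈B = proj₂ (E≠∅ (proj₁ P̂))

        #F<2#T : # F < # T + # T
        #F<2#T = linear 1 (#F<heavy P̂ ⊕ tall P̂) (lemma (# F) (# T) (# B))
          where
          lemma : ∀ f t b → suc f + ((t + b) + t) + 1 ≡ (t + t) + (suc f + suc b)
          lemma = solve-∀

        -- The map sending s to s⁻¹kx takes T ∪ kT into `F`. As |F| < 2|T|, the sets T and kT meet,
        -- so the join of `P̂` with its translate is heavy, and its second component B ∩ kB cannot
        -- be smaller than `B`.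
        block : ∀ {k} → K k → ∀ {x} → x ∈ B → k ∙ x ∈ B → k ◃ B ⊆ B
        block {k} k∈K {x} x∈B kx∈B = ⊆∧≥⇒⊇ B (k ◃ B) B⊆kB (≤-reflexive (#◃ k B))
          where
          kP : Heavy
          kP = translate-heavy k k∈K P̂
          B∩kB : Inhabited (B ∩ k ◃ B)
          B∩kB = k ∙ x , ∩⁺ B (k ◃ B) kx∈B (◃⁺ k B x∈B)
          T∪kT≤ : # (T ∪ k ◃ T) ≤ # F
          T∪kT≤ = injection⇒≤ (T ∪ k ◃ T) F (λ s → s ⁻¹ ∙ (k ∙ x))
            (λ s∈ → [ (λ s∈T → quotient (proj₁ P̂) s∈T kx∈B) , (λ s∈kT → quotient (proj₁ kP) s∈kT (◃⁺ k B x∈B)) ]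
                    (∪⁻ T (k ◃ T) s∈))
            (⁻¹-injective ∘ ∙-cancelʳ (k ∙ x) _ _)
          T∩kT : Inhabited (T ∩ k ◃ T)
          T∩kT = 1≤⇒inhabited (T ∩ k ◃ T) (linear 0
            (T∪kT≤ ⊕ #F<2#T ⊕ ≤-reflexive (≡.trans (≡.cong (# T +_) (≡.sym (#◃ k T))) (≡.sym (#∩+#∪ T (k ◃ T)))))
            (lemma (# (T ∪ k ◃ T)) (# F) (# T) (# (T ∩ k ◃ T))))
            where
            lemma : ∀ u f t i → 1 + (f + ((t + t) + (i + u))) + 0 ≡ i + (u + (suc f + (t + t)))
            lemma = solve-∀
          B⊆kB : B ⊆ k ◃ B
          B⊆kB b∈B = proj₂ (∩⁻ B (k ◃ B) (⊆∧≥⇒⊇ (B ∩ k ◃ B) B (λ x∈ → proj₁ (∩⁻ B (k ◃ B) x∈))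
            (shortest (join (proj₁ P̂) (proj₁ kP) T∩kT B∩kB , join-heavy P̂ kP T∩kT B∩kB)) b∈B))

        -- T⁻¹q and T⁻¹b lie in `F` and overlap since |F| < 2|T|. From s⁻¹q = t⁻¹b one gets bq⁻¹ =
        -- ts⁻¹, with s and t in `K`.
        row : ∀ {b} → b ∈ B → K (b ∙ q ⁻¹)
        row {b} b∈B with pigeonhole (T ◂ q) (T ◂ b) F (◂⊆F q∈B) (◂⊆F b∈B)
                           (≤-trans #F<2#T (≤-reflexive (≡.sym (≡.cong₂ _+_ (#◂ T q) (#◂ T b)))))
          where
          ◂⊆F : ∀ {e} → e ∈ B → T ◂ e ⊆ F
          ◂⊆F {e} e∈B x∈ = let s , s∈T , x≈ = ◂⁻ T e x∈ in ∈-resp F (sym x≈) (quotient (proj₁ P̂) s∈T e∈B)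
        ... | z , z∈ with ◂⁻ T q (proj₁ (∩⁻ (T ◂ q) (T ◂ b) z∈)) | ◂⁻ T b (proj₂ (∩⁻ (T ◂ q) (T ◂ b) z∈))
        ... | s , s∈T , z≈s | t , t∈T , z≈t =
          resp-≈ K≤ ts⁻¹≈bq⁻¹ (∙-closed K≤ (S⊆K (proj₁ P̂) t∈T) (⁻¹-closed K≤ (S⊆K (proj₁ P̂) s∈T)))
          where
          ts⁻¹≈bq⁻¹ : t ∙ s ⁻¹ ≈ b ∙ q ⁻¹
          ts⁻¹≈bq⁻¹ = begin
            t ∙ s ⁻¹                    ≈⟨ ∙-congˡ (//-rightDividesʳ q (s ⁻¹)) ⟨
            t ∙ ((s ⁻¹ ∙ q) ∙ q ⁻¹)     ≈⟨ ∙-congˡ (∙-congʳ (trans (sym z≈s) z≈t)) ⟩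
            t ∙ ((t ⁻¹ ∙ b) ∙ q ⁻¹)     ≈⟨ assoc _ _ _ ⟨
            t ∙ (t ⁻¹ ∙ b) ∙ q ⁻¹       ≈⟨ ∙-congʳ (cancelˡ⁻¹ t b) ⟩
            b ∙ q ⁻¹                    ∎

        -- Apply `block` to (bq⁻¹)⁻¹, which sends b to q. So K′ = Bq⁻¹ is a subgroup, and
        -- `B ▹ (q ⁻¹ ∙ t)` below is the coset K′t.
        row-acts : ∀ {b} → b ∈ B → ∀ {e} → e ∈ B → (b ∙ q ⁻¹) ⁻¹ ∙ e ∈ B
        row-acts {b} b∈B e∈B = block (⁻¹-closed K≤ (row b∈B)) b∈B
          (∈-resp B (sym (trans (∙-congˡ (sym (trans (assoc _ _ _) (trans (∙-congˡ (inverseˡ q)) (identityʳ b)))))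
                                (cancelˡ (b ∙ q ⁻¹) q))) q∈B)
          (◃⁺ _ B e∈B)

        -- By saturation: (bq⁻¹t)⁻¹e = t⁻¹((bq⁻¹)⁻¹e), and `row-acts` keeps the second factor in
        -- `B`.
        T-rows : ∀ {b t} → b ∈ B → t ∈ T → b ∙ (q ⁻¹ ∙ t) ∈ T
        T-rows {b} {t} b∈B t∈T = ∈-resp T (assoc b (q ⁻¹) t) (S-saturated P̂
          (∙-closed K≤ (row b∈B) (S⊆K (proj₁ P̂) t∈T))
          λ {e} e∈B → ∈-resp F (sym (trans (∙-congʳ (⁻¹-anti-homo-∙ (b ∙ q ⁻¹) t)) (assoc _ _ _)))
                               (quotient (proj₁ P̂) t∈T (row-acts b∈B e∈B)))

        rows⊆T : ∀ {t} → t ∈ T → B ▹ (q ⁻¹ ∙ t) ⊆ T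
        rows⊆T {t} t∈T x∈ = let b , b∈B , x≈ = ▹⁻ B (q ⁻¹ ∙ t) x∈ in ∈-resp T (sym x≈) (T-rows b∈B t∈T)

        another-row : ∀ t → Inhabited (T ∖ (B ▹ (q ⁻¹ ∙ t)))
        another-row t = 1≤⇒inhabited (T ∖ Bt) (linear 0
          (tall P̂ ⊕ ≤-reflexive (≡.sym (#∩+#∖ T Bt)) ⊕ ⊆⇒≤ (T ∩ Bt) Bt (λ x∈ → proj₂ (∩⁻ T Bt x∈))
            ⊕ ≤-reflexive (#▹ B (q ⁻¹ ∙ t)))
          (lemma (# B) (# T) (# (T ∩ Bt)) (# (T ∖ Bt)) (# Bt)))
          where
          Bt : FinSet
          Bt = B ▹ (q ⁻¹ ∙ t)
          lemma : ∀ b t i d r → 1 + (t + ((i + d) + (r + b))) + 0 ≡ d + (suc b + (t + (i + r)))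
          lemma = solve-∀

        rows-disjoint : ∀ {t u z} → z ∈ B ▹ (q ⁻¹ ∙ t) → z ∈ B ▹ (q ⁻¹ ∙ u) → u ∈ B ▹ (q ⁻¹ ∙ t)
        rows-disjoint {t} {u} {z} z∈t z∈u =
          let b , b∈B , z≈b = ▹⁻ B _ z∈t
              a , a∈B , z≈a = ▹⁻ B _ z∈u
          in ∈-resp (B ▹ (q ⁻¹ ∙ t)) (eq a b (trans (sym z≈b) z≈a)) (▹⁺ B (q ⁻¹ ∙ t) (row-acts a∈B b∈B))
          where
          eq : ∀ a b → b ∙ (q ⁻¹ ∙ t) ≈ a ∙ (q ⁻¹ ∙ u) → (a ∙ q ⁻¹) ⁻¹ ∙ b ∙ (q ⁻¹ ∙ t) ≈ u
          eq a b bt≈au = begin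
            (a ∙ q ⁻¹) ⁻¹ ∙ b ∙ (q ⁻¹ ∙ t)    ≈⟨ assoc _ _ _ ⟩
            (a ∙ q ⁻¹) ⁻¹ ∙ (b ∙ (q ⁻¹ ∙ t))  ≈⟨ ∙-congˡ bt≈au ⟩
            (a ∙ q ⁻¹) ⁻¹ ∙ (a ∙ (q ⁻¹ ∙ u))  ≈⟨ ∙-congˡ (assoc _ _ _) ⟨
            (a ∙ q ⁻¹) ⁻¹ ∙ (a ∙ q ⁻¹ ∙ u)    ≈⟨ cancelˡ _ _ ⟩
            u                                 ∎

        -- `T` contains K′t for each of its elements t and is larger than one such coset, so it
        -- contains two disjoint ones, each of size |B|.
        2#B≤#T : # B + # B ≤ # T
        2#B≤#T = ≮⇒≥ λ #T<2#B →
          let t , t∈T = S≠∅ (proj₁ P̂)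
              u , u∈  = another-row t
              u∈T , u∉ = ∖⁻ T (B ▹ (q ⁻¹ ∙ t)) u∈
              z , z∈ = pigeonhole (B ▹ (q ⁻¹ ∙ t)) (B ▹ (q ⁻¹ ∙ u)) T (rows⊆T t∈T) (rows⊆T u∈T)
                (≤-trans #T<2#B (≤-reflexive (≡.sym (≡.cong₂ _+_ (#▹ B (q ⁻¹ ∙ t)) (#▹ B (q ⁻¹ ∙ u))))))
              z∈t , z∈u = ∩⁻ (B ▹ (q ⁻¹ ∙ t)) (B ▹ (q ⁻¹ ∙ u)) z∈
          in u∉ (rows-disjoint z∈t z∈u)

        flipped⊆F : q ⁻¹ ◃ T ⊆ F
        flipped⊆F x∈ = ∈-resp F (trans (⁻¹-quotient _ _) (cancelʳ⁻ _)) (F⁻¹ (quotient (proj₁ P̂) (◃⁻ (q ⁻¹) T x∈) q∈B))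
          where
          cancelʳ⁻ : ∀ x → q ⁻¹ ∙ (q ⁻¹ ⁻¹ ∙ x) ≈ x
          cancelʳ⁻ = cancelˡ⁻¹ (q ⁻¹)

        -- Sending s to s⁻¹b matches this set with the intersection of T⁻¹b and q⁻¹T, two subsets of
        -- `F` of size |T|.
        common : Carrier → FinSet
        common b = ⟨ T ∣ (λ s → s ⁻¹ ∙ b ∈ q ⁻¹ ◃ T) ⟩

        common-resp : ∀ b → (λ s → s ⁻¹ ∙ b ∈ q ⁻¹ ◃ T) Respects _≈_
        common-resp b s≈t = ∈-resp (q ⁻¹ ◃ T) (∙-congʳ (⁻¹-cong s≈t))

        2#T≤ : ∀ {b} → b ∈ B → # T + # T ≤ # F + # (common b)
        2#T≤ {b} b∈B = linear 0
          (⊆⇒≤ ((T ◂ b) ∪ (q ⁻¹ ◃ T)) F (λ x∈ → [ ◂⊆F , flipped⊆F ] (∪⁻ (T ◂ b) (q ⁻¹ ◃ T) x∈))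
            ⊕ ≤-reflexive (≡.sym (≡.trans (#∩+#∪ (T ◂ b) (q ⁻¹ ◃ T)) (≡.cong₂ _+_ (#◂ T b) (#◃ (q ⁻¹) T))))
            ⊕ injection⇒≤ ((T ◂ b) ∩ (q ⁻¹ ◃ T)) (common b) (λ x → b ∙ x ⁻¹) ∩⊆common (⁻¹-injective ∘ ∙-cancelˡ b _ _))
          (lemma (# ((T ◂ b) ∪ (q ⁻¹ ◃ T))) (# F) (# T) (# ((T ◂ b) ∩ (q ⁻¹ ◃ T))) (# (common b)))
          where
          ◂⊆F : T ◂ b ⊆ F
          ◂⊆F x∈ = let s , s∈T , x≈ = ◂⁻ T b x∈ in ∈-resp F (sym x≈) (quotient (proj₁ P̂) s∈T b∈B)
          ∩⊆common : ∀ {x} → x ∈ (T ◂ b) ∩ (q ⁻¹ ◃ T) → b ∙ x ⁻¹ ∈ common b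
          ∩⊆common {x} x∈ =
            let x∈T◂b , x∈flip = ∩⁻ (T ◂ b) (q ⁻¹ ◃ T) x∈
                s , s∈T , x≈ = ◂⁻ T b x∈T◂b
            in ∈-resp (common b) (sym (trans (∙-congˡ (trans (⁻¹-cong x≈) (⁻¹-quotient s b))) (cancelˡ⁻¹ b s)))
                 (sift⁺ T (common-resp b) s∈T (∈-resp (q ⁻¹ ◃ T) x≈ x∈flip))
          lemma : ∀ u f t i m → (t + t) + (f + ((i + u) + m)) + 0 ≡ (f + m) + (u + ((t + t) + i))
          lemma = solve-∀

        common⊆T : ∀ b → common b ⊆ T
        common⊆T b x∈ = proj₁ (sift⁻ T (common-resp b) x∈)

        -- `common q` and `common b` have at least 2|T| - |F| elements each, and 2|F| < 2|T| + 2|B|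
        -- ≤ 3|T|, so they meet inside `T`. For a common s both qs⁻¹q and qs⁻¹b lie in `K`, and q⁻¹b
        -- is the inverse of the first times the second.
        column : ∀ {b} → b ∈ B → K (q ⁻¹ ∙ b)
        column {b} b∈B = resp-≈ K≤ (trans (quotient-shift _ _ _) (quotient-shift _ _ _))
          (∙-closed K≤ (⁻¹-closed K≤ (in-K q (proj₁ s∈))) (in-K b (proj₂ s∈)))
          where
          lemma : ∀ f t b m n → suc t + ((f + m) + ((f + n) + ((t + b) + ((t + b) + t)))) + 1
                  ≡ (m + n) + ((t + t) + ((t + t) + (suc f + (suc f + (b + b)))))
          lemma = solve-∀
          meeting : Inhabited (common q ∩ common b)
          meeting = pigeonhole (common q) (common b) T (common⊆T q) (common⊆T b)
            (linear 1 (2#T≤ q∈B ⊕ 2#T≤ b∈B ⊕ #F<heavy P̂ ⊕ #F<heavy P̂ ⊕ 2#B≤#T)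
                      (lemma (# F) (# T) (# B) (# (common q)) (# (common b))))
          s : Carrier
          s = proj₁ meeting
          s∈ : s ∈ common q × s ∈ common b
          s∈ = ∩⁻ (common q) (common b) (proj₂ meeting)
          in-K : ∀ a → s ∈ common a → K (q ⁻¹ ⁻¹ ∙ (s ⁻¹ ∙ a))
          in-K a s∈a = S⊆K (proj₁ P̂) (◃⁻ (q ⁻¹) T (proj₂ (sift⁻ T (common-resp a) s∈a)))

        flip : Heavy
        flip = record
          { S = q ⁻¹ ◃ B ; E = q ⁻¹ ◃ T
          ; S⊆K = λ x∈ → resp-≈ K≤ (cancelˡ⁻¹ (q ⁻¹) _) (column (◃⁻ (q ⁻¹) B x∈))
          ; S≠∅ = _ , ◃⁺ (q ⁻¹) B q∈B
          ; E≠∅ = _ , ◃⁺ (q ⁻¹) T (proj₂ (S≠∅ (proj₁ P̂)))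
          ; quotient = λ s∈ e∈ → quotient-swap F F⁻¹ (∈-resp F (quotient-shift (q ⁻¹ ⁻¹) _ _)
              (quotient (proj₁ P̂) (◃⁻ (q ⁻¹) T e∈) (◃⁻ (q ⁻¹) B s∈)))
          } , ≤-trans (proj₂ P̂) (≤-reflexive (≡.trans (+-comm (# T) (# B))
                (≡.cong₂ _+_ (≡.sym (#◃ (q ⁻¹) B)) (≡.sym (#◃ (q ⁻¹) T)))))

        absurd : ∀ {w} {W : Set w} → W
        absurd = impossible 1 (tall flip ⊕ tall P̂ ⊕ ≤-reflexive (#◃ (q ⁻¹) B) ⊕ ≤-reflexive (≡.sym (#◃ (q ⁻¹) T)))
          (lemma (# T) (# B) (# (q ⁻¹ ◃ T)) (# (q ⁻¹ ◃ B)))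
          where
          lemma : ∀ t b t′ b′ → 1 + (b′ + (t + (b + t′))) + 1 ≡ suc t′ + (suc b + (b′ + t))
          lemma = solve-∀

      flat : Heavy → Σ[ (P , _) ∈ Heavy ] # (S P) ≤ # (E P)
      flat P₀ with em {Σ[ (P , _) ∈ Heavy ] # (S P) ≤ # (E P)}
      ... | yes P  = P
      ... | no  ∄P = let P̂ , shortest = argmin em (λ (P , _) → # (E P)) P₀ in
        AllTall.absurd (λ P → ≰⇒> λ S≤E → ∄P (P , S≤E)) P̂ shortest

      -- A subgroup from a heaviest pair.

      record Period : Set (c ⊔ ℓ) where
        field
          heaviest : Heavy

        K₁ : FinSet
        K₁ = S (proj₁ heaviest)

        E₁ : FinSet
        E₁ = E (proj₁ heaviest)

        field
          ε∈K₁     : ε ∈ K₁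
          K₁K₁⊆K₁  : ∀ {k l} → k ∈ K₁ → l ∈ K₁ → k ∙ l ∈ K₁
          K₁⁻¹⊆K₁  : Symmetric K₁
          K₁E₁⊆E₁  : ∀ {k e} → k ∈ K₁ → e ∈ E₁ → k ∙ e ∈ E₁
          E₁K₁⊆E₁  : ∀ {e k} → e ∈ E₁ → k ∈ K₁ → e ∙ k ∈ E₁
          E₁⁻¹⊆E₁  : Symmetric E₁
          #K₁≤#E₁  : # K₁ ≤ # E₁

      module Least (M : Heavy) (least : ∀ ((Q , _) : Heavy) → # (S (proj₁ M)) ≤ # (S Q))
                   (ε∈K₁ : ε ∈ S (proj₁ M)) (#K₁≤#E₁ : # (S (proj₁ M)) ≤ # (E (proj₁ M))) where

        K₁ E₁ : FinSet
        K₁ = S (proj₁ M)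
        E₁ = E (proj₁ M)

        -- The meet of `M` with its translate by k⁻¹ is heavy, so minimality makes K₁ ∩ k⁻¹K₁ all of
        -- `K₁`. The first components share `ε`; the second ones lie in `F` and meet because 2|E₁| ≥
        -- |K₁| + |E₁| > |F|.
        shift : ∀ {k} → k ∈ K₁ → K₁ ⊆ k ⁻¹ ◃ K₁
        shift {k} k∈K₁ x∈K₁ = proj₂ (∩⁻ K₁ (k ⁻¹ ◃ K₁) (⊆∧≥⇒⊇ (K₁ ∩ k ⁻¹ ◃ K₁) K₁
            (λ x∈ → proj₁ (∩⁻ K₁ (k ⁻¹ ◃ K₁) x∈)) 
            (least (meet (proj₁ M) (proj₁ kM) K₁∩kK₁ E₁∩kE₁ , meet-heavy M kM K₁∩kK₁ E₁∩kE₁)) x∈K₁))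
          where
          kM : Heavy
          kM = translate-heavy (k ⁻¹) (⁻¹-closed K≤ (S⊆K (proj₁ M) k∈K₁)) M
          ε∈kK₁ : ε ∈ k ⁻¹ ◃ K₁
          ε∈kK₁ = ◃⁺⁻¹ (k ⁻¹) K₁ (∈-resp K₁ (sym (trans (identityʳ _) (⁻¹-involutive k))) k∈K₁)
          K₁∩kK₁ : Inhabited (K₁ ∩ k ⁻¹ ◃ K₁)
          K₁∩kK₁ = ε , ∩⁺ K₁ (k ⁻¹ ◃ K₁) ε∈K₁ ε∈kK₁
          E₁∩kE₁ : Inhabited (E₁ ∩ k ⁻¹ ◃ E₁)
          E₁∩kE₁ = pigeonhole E₁ (k ⁻¹ ◃ E₁) F
            (λ e∈ → ∈-resp F (ε⁻¹∙ _) (quotient (proj₁ M) ε∈K₁ e∈))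
            (λ e∈ → ∈-resp F (ε⁻¹∙ _) (quotient (proj₁ kM) ε∈kK₁ e∈))
            (linear 0 (#F<heavy M ⊕ #K₁≤#E₁ ⊕ ≤-reflexive (≡.sym (#◃ (k ⁻¹) E₁)))
                      (lemma (# F) (# K₁) (# E₁) (# (k ⁻¹ ◃ E₁))))
            where
            lemma : ∀ f k e e′ → suc f + ((k + e) + (e + e′)) + 0 ≡ (e + e′) + (suc f + (k + e))
            lemma = solve-∀

        K₁K₁⊆K₁ : ∀ {k l} → k ∈ K₁ → l ∈ K₁ → k ∙ l ∈ K₁
        K₁K₁⊆K₁ {k} {l} k∈ l∈ = ∈-resp K₁ (∙-congʳ (⁻¹-involutive k)) (◃⁻ (k ⁻¹) K₁ (shift k∈ l∈))

        K₁⁻¹⊆K₁ : Symmetric K₁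
        K₁⁻¹⊆K₁ {k} k∈ = ⊆∧≥⇒⊇ K₁ (k ⁻¹ ◃ K₁) (shift k∈) (≤-reflexive (#◃ (k ⁻¹) K₁))
          (∈-resp (k ⁻¹ ◃ K₁) (identityʳ (k ⁻¹)) (◃⁺ (k ⁻¹) K₁ ε∈K₁))

        -- Saturation applies, as s⁻¹(ke) = (k⁻¹s)⁻¹e with k⁻¹s in `K₁`.
        K₁E₁⊆E₁ : ∀ {k e} → k ∈ K₁ → e ∈ E₁ → k ∙ e ∈ E₁
        K₁E₁⊆E₁ {k} {e} k∈ e∈ = E-saturated M λ {s} s∈ →
          ∈-resp F (trans (∙-congˡ (sym (cancelˡ k e))) (quotient-shift (k ⁻¹) s (k ∙ e)))
                   (quotient (proj₁ M) (K₁K₁⊆K₁ (K₁⁻¹⊆K₁ k∈) s∈) e∈)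

        right : Carrier → FinSet
        right d = ⟨ K₁ ∣ (λ k → d ∙ k ∈ E₁) ⟩

        right-resp : ∀ d → (λ k → d ∙ k ∈ E₁) Respects _≈_
        right-resp d k≈l = ∈-resp E₁ (∙-congˡ k≈l)

        right⁻ : ∀ {d k} → k ∈ right d → k ∈ K₁ × d ∙ k ∈ E₁
        right⁻ {d} = sift⁻ K₁ (right-resp d)

        right⁺ : ∀ {d k} → k ∈ K₁ → d ∙ k ∈ E₁ → k ∈ right d
        right⁺ {d} = sift⁺ K₁ (right-resp d)

        module _ {d} (d∈E₁ : d ∈ E₁) where

          -- Write s⁻¹e = (ds)⁻¹(de). When de is in `K₁`, this is the inverse of an element of
          -- K₁⁻¹E₁. Symmetry of `F` thus adds d⁻¹K₁ to the second component, at the cost of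
          -- shrinking the first to `right d`.
          twisted : Pair
          twisted = record
            { S = right d ; E = E₁ ∪ d ⁻¹ ◃ K₁
            ; S⊆K = λ s∈ → S⊆K (proj₁ M) (proj₁ (right⁻ s∈))
            ; S≠∅ = ε , right⁺ ε∈K₁ (∈-resp E₁ (sym (identityʳ d)) d∈E₁)
            ; E≠∅ = d , ∪⁺ˡ E₁ (d ⁻¹ ◃ K₁) d∈E₁
            ; quotient = λ {s} {e} s∈ e∈ → let s∈K₁ , ds∈E₁ = right⁻ s∈ in
                [ quotient (proj₁ M) s∈K₁
                , (λ e∈ → ∈-resp F (trans (∙-congˡ (∙-congʳ (⁻¹-involutive d))) (quotient-shift d s e))
                            (quotient-swap F F⁻¹ (quotient (proj₁ M) (◃⁻ (d ⁻¹) K₁ e∈) ds∈E₁)))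
                ] (∪⁻ E₁ (d ⁻¹ ◃ K₁) e∈)
            }

          #∩≤#right : # (E₁ ∩ d ⁻¹ ◃ K₁) ≤ # (right (d ⁻¹))
          #∩≤#right = injection⇒≤ (E₁ ∩ d ⁻¹ ◃ K₁) (right (d ⁻¹)) (d ⁻¹ ⁻¹ ∙_)
            (λ x∈ → let x∈E₁ , x∈ = ∩⁻ E₁ (d ⁻¹ ◃ K₁) x∈ in
              right⁺ (◃⁻ (d ⁻¹) K₁ x∈) (∈-resp E₁ (sym (cancelˡ⁻¹ (d ⁻¹) _)) x∈E₁))
            (∙-cancelˡ _ _ _)

          #E₁∩+#E₁∪ : # (E₁ ∩ d ⁻¹ ◃ K₁) + # (E₁ ∪ d ⁻¹ ◃ K₁) ≡ # E₁ + # K₁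
          #E₁∩+#E₁∪ = ≡.trans (#∩+#∪ E₁ (d ⁻¹ ◃ K₁)) (≡.cong (# E₁ +_) (#◃ (d ⁻¹) K₁))

          -- `twisted` weighs |right d| + |E₁| + |K₁| - |E₁ ∩ d⁻¹K₁|, which is at most |K₁| + |E₁|.
          -- Multiplication by d carries the intersection into `right (d ⁻¹)`.
          #right-⁻¹ : # (right d) ≤ # (right (d ⁻¹))
          #right-⁻¹ = linear 0 (≤maximum twisted ⊕ proj₂ M ⊕ ≤-reflexive (≡.sym #E₁∩+#E₁∪) ⊕ #∩≤#right)
            (lemma (# (right d)) (# (right (d ⁻¹))) maximum (# K₁) (# E₁) (# (E₁ ∩ d ⁻¹ ◃ K₁)) (# (E₁ ∪ d ⁻¹ ◃ K₁)))
            where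
            lemma : ∀ a b w k e i u → a + (w + ((k + e) + ((i + u) + b))) + 0 ≡ b + ((a + u) + (w + ((e + k) + i)))
            lemma = solve-∀

          -- Equality holds throughout when d⁻¹ ∈ E₁ too, so that the pair is
          -- heavy and the minimality of K₁ applies.
          right-full : # (right (d ⁻¹)) ≤ # (right d) → K₁ ⊆ right d
          right-full ≤right = ⊆∧≥⇒⊇ (right d) K₁ (λ k∈ → proj₁ (right⁻ k∈)) (least (twisted , linear 0
              (proj₂ M ⊕ ≤-reflexive (≡.sym #E₁∩+#E₁∪) ⊕ #∩≤#right ⊕ ≤right)
              (lemma (# (right d)) (# (right (d ⁻¹))) maximum (# K₁) (# E₁) (# (E₁ ∩ d ⁻¹ ◃ K₁)) (# (E₁ ∪ d ⁻¹ ◃ K₁)))))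
            where
            lemma : ∀ a b w k e i u → w + ((k + e) + ((i + u) + (b + a))) + 0 ≡ (a + u) + (w + ((e + k) + (i + b)))
            lemma = solve-∀

        -- The inequality that `right-full` asks for is `#right-⁻¹` at e⁻¹.
        E₁K₁⊆E₁-sym : ∀ {e k} → e ∈ E₁ → e ⁻¹ ∈ E₁ → k ∈ K₁ → e ∙ k ∈ E₁
        E₁K₁⊆E₁-sym {e} e∈ e⁻¹∈ k∈ = proj₂ (right⁻ (right-full e∈
          (≤-trans (#right-⁻¹ e⁻¹∈) (⊆⇒≤ (right (e ⁻¹ ⁻¹)) (right e)
            λ k∈ → let k∈K₁ , ek∈ = right⁻ k∈ in right⁺ k∈K₁ (∈-resp E₁ (∙-congʳ (⁻¹-involutive e)) ek∈))) k∈))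

        -- `right (e ⁻¹)` is inhabited because `right e` contains `ε`. For `l` in it, l⁻¹e and its
        -- inverse both lie in `E₁`; the symmetric case gives l⁻¹ek ∈ E₁, and `l` is then cancelled
        -- by left invariance.
        E₁K₁⊆E₁ : ∀ {e k} → e ∈ E₁ → k ∈ K₁ → e ∙ k ∈ E₁
        E₁K₁⊆E₁ {e} {k} e∈ k∈ = ∈-resp E₁ (trans (∙-congˡ (assoc _ _ _)) (cancelˡ⁻¹ l (e ∙ k)))
          (K₁E₁⊆E₁ l∈K₁ (E₁K₁⊆E₁-sym l⁻¹e∈ (∈-resp E₁ (sym (⁻¹-quotient l e)) e⁻¹l∈) k∈))
          where
          turn : Inhabited (right (e ⁻¹))
          turn = 1≤⇒inhabited (right (e ⁻¹)) (≤-trans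
            (inhabited⇒1≤ (right e) (ε , right⁺ ε∈K₁ (∈-resp E₁ (sym (identityʳ e)) e∈))) (#right-⁻¹ e∈))
          l : Carrier
          l = proj₁ turn
          l∈K₁ : l ∈ K₁
          l∈K₁ = proj₁ (right⁻ (proj₂ turn))
          e⁻¹l∈ : e ⁻¹ ∙ l ∈ E₁
          e⁻¹l∈ = proj₂ (right⁻ (proj₂ turn))
          l⁻¹e∈ : l ⁻¹ ∙ e ∈ E₁
          l⁻¹e∈ = K₁E₁⊆E₁ (K₁⁻¹⊆K₁ l∈K₁) e∈

        -- Saturation again: s⁻¹e⁻¹ = (es)⁻¹, and es ∈ E₁ ⊆ F.
        E₁⁻¹⊆E₁ : Symmetric E₁
        E₁⁻¹⊆E₁ {e} e∈ = E-saturated M λ {s} s∈ → ∈-resp F (⁻¹-anti-homo-∙ e s)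
          (F⁻¹ (∈-resp F (ε⁻¹∙ _) (quotient (proj₁ M) ε∈K₁ (E₁K₁⊆E₁ e∈ s∈))))

        period : Period
        period = record
          { heaviest = M ; ε∈K₁ = ε∈K₁ ; K₁K₁⊆K₁ = K₁K₁⊆K₁ ; K₁⁻¹⊆K₁ = K₁⁻¹⊆K₁
          ; K₁E₁⊆E₁ = K₁E₁⊆E₁ ; E₁K₁⊆E₁ = E₁K₁⊆E₁ ; E₁⁻¹⊆E₁ = E₁⁻¹⊆E₁ ; #K₁≤#E₁ = #K₁≤#E₁ }

      module Normalise (M : Heavy) (least : ∀ ((Q , _) : Heavy) → # (S (proj₁ M)) ≤ # (S Q)) where

        s : Carrier
        s = proj₁ (S≠∅ (proj₁ M))

        s∈ : s ∈ S (proj₁ M)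
        s∈ = proj₂ (S≠∅ (proj₁ M))

        N : Heavy
        N = translate-heavy (s ⁻¹) (⁻¹-closed K≤ (S⊆K (proj₁ M) s∈)) M

        least-N : ∀ ((Q , _) : Heavy) → # (S (proj₁ N)) ≤ # (S Q)
        least-N Q = ≤-trans (≤-reflexive (#◃ (s ⁻¹) (S (proj₁ M)))) (least Q)

        ε∈N : ε ∈ S (proj₁ N)
        ε∈N = ◃⁺⁻¹ (s ⁻¹) (S (proj₁ M)) (∈-resp (S (proj₁ M)) (sym (trans (identityʳ _) (⁻¹-involutive s))) s∈)

        -- The first component of `N` is no larger than that of `P`, which is at most half of
        -- `maximum`.
        flat-N : ∀ ((P , _) : Heavy) → # (S P) ≤ # (E P) → # (S (proj₁ N)) ≤ # (E (proj₁ N))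
        flat-N (P , w≤P) S≤E = linear 0
          (least-N (P , w≤P) ⊕ least-N (P , w≤P) ⊕ S≤E ⊕ ≤maximum P ⊕ proj₂ N)
          (lemma (# (S (proj₁ N))) (# (E (proj₁ N))) (# (S P)) (# (E P)) maximum)
          where
          lemma : ∀ s e s′ e′ w → s + (s′ + (s′ + (e′ + (w + (s + e))))) + 0 ≡ e + (s + (s + (s′ + ((s′ + e′) + w))))
          lemma = solve-∀

      period : Heavy → Period
      period P₀ = Least.period N least-N ε∈N (flat-N (proj₁ (flat P₀)) (proj₂ (flat P₀)))
        where
        shortest : Σ[ (M , _) ∈ Heavy ] ∀ ((Q , _) : Heavy) → # (S M) ≤ # (S Q)
        shortest = argmin em (λ (P , _) → # (S P)) P₀
        open Normalise (proj₁ shortest) (proj₂ shortest)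

  -- Descent to the part of `F` outside `E₁`.

  module Descend (K : Pred Carrier (c ⊔ ℓ)) (K≤ : IsSubgroup K) (F : FinSet) (F⁻¹ : Symmetric F) where

    open Pairs K K≤ F

    module _ (maximum : ℕ) (≤maximum : ∀ P → weight P ≤ maximum) (#F<maximum : # F < maximum) where

      open Heaviest F⁻¹ maximum ≤maximum #F<maximum

      module Along (Π : Period) (κ : ℕ) (1≤κ : 1 ≤ κ) (#F+κ≤maximum : # F + κ ≤ maximum) where

        open Period Π

        B : Pair
        B = proj₁ heaviest

        E₁⊆F : E₁ ⊆ F
        E₁⊆F e∈ = ∈-resp F (ε⁻¹∙ _) (quotient B ε∈K₁ e∈)

        F₁ : FinSet
        F₁ = F ∖ E₁

        F₁⁺ : ∀ {x} → x ∈ F → x ∉ E₁ → x ∈ F₁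
        F₁⁺ = ∖⁺ F E₁

        F₁⁻ : ∀ {x} → x ∈ F₁ → x ∈ F × x ∉ E₁
        F₁⁻ = ∖⁻ F E₁

        F₁⁻¹ : Symmetric F₁
        F₁⁻¹ x∈ = let x∈F , x∉E₁ = F₁⁻ x∈ in
          F₁⁺ (F⁻¹ x∈F) (λ x⁻¹∈E₁ → x∉E₁ (∈-resp E₁ (⁻¹-involutive _) (E₁⁻¹⊆E₁ x⁻¹∈E₁)))

        #F≥ : # E₁ + # F₁ ≤ # F
        #F≥ = ≤-trans (+-monoˡ-≤ (# F₁) (⊆⇒≤ E₁ (F ∩ E₁) (λ x∈ → ∩⁺ F E₁ (E₁⊆F x∈) x∈)))
                      (≤-reflexive (#∩+#∖ F E₁))

        -- Remove `E₁` from |F| + κ ≤ |K₁| + |E₁|. A single coset of `K₁` thus outnumbers everything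
        -- that is left.
        #F₁+κ≤#K₁ : # F₁ + κ ≤ # K₁
        #F₁+κ≤#K₁ = linear 0 (#F+κ≤maximum ⊕ proj₂ heaviest ⊕ #F≥) (lemma (# F₁) κ (# F) maximum (# K₁) (# E₁))
          where
          lemma : ∀ f₁ κ f w k e → f₁ + κ + (w + ((k + e) + f)) + 0 ≡ k + ((f + κ) + (w + (e + f₁)))
          lemma = solve-∀

        K₁≤ : IsSubgroup (_∈ K₁)
        K₁≤ = record { resp-≈ = ∈-resp K₁ ; ε-closed = ε∈K₁ ; ∙-closed = K₁K₁⊆K₁ ; ⁻¹-closed = K₁⁻¹⊆K₁ }

        E₁-translate : ∀ {k x} → k ∈ K₁ → k ⁻¹ ∙ x ∈ E₁ → x ∈ E₁
        E₁-translate k∈ x∈ = ∈-resp E₁ (cancelˡ⁻¹ _ _) (K₁E₁⊆E₁ k∈ x∈)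

        module P₁ = Pairs (_∈ K₁) K₁≤ F₁

        -- If E meets E₁, intersecting C with (K₁ , E₁) gives a pair for F₁. Otherwise let
        -- Sₐ consist of the s ∈ S with s⁻¹f ∈ E₁, and S_b of the others. Then E ⊆ fK₁,
        -- because Sₐ together with two cosets of K₁ would be too heavy, and
        -- (f⁻¹E , f⁻¹S_b) is a pair for F₁ which reaches f⁻¹.
        module _ {f : Carrier} (f∈F₁ : f ∈ F₁) (C : Pair) (ε∈S : ε ∈ S C) (f∈E : f ∈ E C)
                 (C-heavy : # F + κ ≤ weight C)
                 (C-short : ∀ Q → ε ∈ S Q → f ∈ E Q → weight C ≤ weight Q → # (E C) ≤ # (E Q)) where

          -- The meet with (K₁ , E₁) weighs at least as much as `C`, since the join weighs at most
          -- `maximum`. Removing `E₁` from its second component leaves at least |F₁| + κ, and the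
          -- quotients avoid `E₁` because `E₁` is invariant under `K₁`.
          inside : Inhabited (E₁ ∩ E C) → P₁.Cover (# F₁ + κ) f
          inside E₁∩E≠∅ = record
              { S = K₁ ∩ S C ; E = E C ∖ E₁
              ; S⊆K = λ x∈ → proj₁ (∩⁻ K₁ (S C) x∈)
              ; S≠∅ = K₁∩S≠∅
              ; E≠∅ = f , f∈E∖E₁
              ; quotient = λ s∈ e∈ → let s∈K₁ , s∈S = ∩⁻ K₁ (S C) s∈ ; e∈E , e∉E₁ = ∖⁻ (E C) E₁ e∈ in
                  F₁⁺ (quotient C s∈S e∈E) (λ s⁻¹e∈ → e∉E₁ (E₁-translate s∈K₁ s⁻¹e∈))
              } , (ε∈K₁∩S , f∈E∖E₁) , linear 0
              (C-heavy ⊕ #F≥ ⊕ proj₂ heaviest ⊕ ≤maximum (join B C K₁∩S≠∅ E₁∩E≠∅)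
                ⊕ ≤-reflexive (≡.sym (weight-modular B C K₁∩S≠∅ E₁∩E≠∅)) ⊕ ≤-reflexive (#∪ E₁ (E C)))
              (lemma (# F₁) κ (# F) (# E₁) maximum (weight B) (weight C) (weight (join B C K₁∩S≠∅ E₁∩E≠∅))
                     (# (K₁ ∩ S C)) (# (E₁ ∪ E C)) (# (E C ∖ E₁)))
            where
            ε∈K₁∩S : ε ∈ K₁ ∩ S C
            ε∈K₁∩S = ∩⁺ K₁ (S C) ε∈K₁ ε∈S
            K₁∩S≠∅ : Inhabited (K₁ ∩ S C)
            K₁∩S≠∅ = ε , ε∈K₁∩S
            f∈E∖E₁ : f ∈ E C ∖ E₁
            f∈E∖E₁ = ∖⁺ (E C) E₁ f∈E (proj₂ (F₁⁻ f∈F₁))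
            lemma : ∀ f₁ κ f e₁ w b c j s u d →
              f₁ + κ + (c + (f + (b + (w + ((s + u + j) + (e₁ + d)))))) + 0
              ≡ s + d + (f + κ + (e₁ + f₁ + (w + (j + ((b + c) + u)))))
            lemma = solve-∀

          module Outside (disjoint : ¬ Inhabited (E₁ ∩ E C)) where

            E⊆F₁ : E C ⊆ F₁
            E⊆F₁ e∈ = F₁⁺ (∈-resp F (ε⁻¹∙ _) (quotient C ε∈S e∈)) (λ e∈E₁ → disjoint (_ , ∩⁺ E₁ (E C) e∈E₁ e∈))

            Near : Pred Carrier (c ⊔ ℓ)
            Near s = s ⁻¹ ∙ f ∈ E₁

            near-resp : Near Respects _≈_
            near-resp s≈t = ∈-resp E₁ (∙-congʳ (⁻¹-cong s≈t))

            Sₐ S_b : FinSet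
            Sₐ  = ⟨ S C ∣ Near ⟩
            S_b = ⟨ S C ∣ (λ s → ¬ Near s) ⟩

            Sₐ⁻ : ∀ {s} → s ∈ Sₐ → s ∈ S C × Near s
            Sₐ⁻ = sift⁻ (S C) near-resp

            S_b⁻ : ∀ {s} → s ∈ S_b → s ∈ S C × ¬ Near s
            S_b⁻ = sift⁻ (S C) (¬-resp near-resp)

            -- The join of `C` with (sK₁ , sE₁) still covers `f` and weighs at least as much as `C`.
            -- By `C-short` its second component E ∩ sE₁ is all of `E`.
            near : ∀ {s e} → s ∈ Sₐ → e ∈ E C → s ⁻¹ ∙ e ∈ E₁
            near {s} s∈ e∈ = ◃⁻ s E₁ (proj₂ (∩⁻ (E C) (s ◃ E₁)
              (⊆∧≥⇒⊇ (E C ∩ s ◃ E₁) (E C) (λ x∈ → proj₁ (∩⁻ (E C) (s ◃ E₁) x∈))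
                (C-short J (∪⁺ˡ (S C) (s ◃ K₁) ε∈S) f∈∩ J-heavy) e∈)))
              where
              s∈S : s ∈ S C
              s∈S = proj₁ (Sₐ⁻ s∈)
              sB : Heavy
              sB = translate-heavy s (S⊆K C s∈S) heaviest
              s∈∩ : s ∈ S C ∩ s ◃ K₁
              s∈∩ = ∩⁺ (S C) (s ◃ K₁) s∈S (∈-resp (s ◃ K₁) (identityʳ s) (◃⁺ s K₁ ε∈K₁))
              f∈∩ : f ∈ E C ∩ s ◃ E₁
              f∈∩ = ∩⁺ (E C) (s ◃ E₁) f∈E (◃⁺⁻¹ s E₁ (proj₂ (Sₐ⁻ s∈)))
              J M : Pair
              J = join C (proj₁ sB) (s , s∈∩) (f , f∈∩)
              M = meet C (proj₁ sB) (s , s∈∩) (f , f∈∩)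
              J-heavy : weight C ≤ weight J
              J-heavy = linear 0
                (≤maximum M ⊕ proj₂ sB ⊕ ≤-reflexive (≡.sym (weight-modular C (proj₁ sB) (s , s∈∩) (f , f∈∩))))
                (lemma (weight C) (weight J) (weight M) maximum (weight (proj₁ sB)))
                where
                lemma : ∀ c j m w b → c + (w + (b + (m + j))) + 0 ≡ j + (m + (w + (c + b)))
                lemma = solve-∀

            #S≤#Sₐ+#S_b : # (S C) ≤ # Sₐ + # S_b
            #S≤#Sₐ+#S_b = ≤-reflexive (≡.sym (#sift (S C) Near))

            #S_b≤#F₁ : # S_b ≤ # F₁
            #S_b≤#F₁ = injection⇒≤ S_b F₁ (λ s → s ⁻¹ ∙ f)
              (λ s∈ → F₁⁺ (quotient C (proj₁ (S_b⁻ s∈)) f∈E) (proj₂ (S_b⁻ s∈))) (proj₂ (⁻¹∙-injection f))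

            #E≤#F₁ : # (E C) ≤ # F₁
            #E≤#F₁ = ⊆⇒≤ (E C) F₁ E⊆F₁

            #Sₐ≤#E₁ : # Sₐ ≤ # E₁
            #Sₐ≤#E₁ = injection⇒≤ Sₐ E₁ (λ s → s ⁻¹ ∙ f) (λ s∈ → proj₂ (Sₐ⁻ s∈)) (proj₂ (⁻¹∙-injection f))

            #E₁+#F₁+κ≤ : # E₁ + # F₁ + κ ≤ weight C
            #E₁+#F₁+κ≤ = ≤-trans (+-monoˡ-≤ κ #F≥) C-heavy

            -- |Sₐ| ≥ |S| - |F₁| ≥ |E₁| + κ - |F₁| ≥ |K₁| + κ - |F₁| ≥ 2κ.
            Sₐ≠∅ : Inhabited Sₐ
            Sₐ≠∅ = 1≤⇒inhabited Sₐ (linear κ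
              (#S≤#Sₐ+#S_b ⊕ #S_b≤#F₁ ⊕ #E≤#F₁ ⊕ #E₁+#F₁+κ≤ ⊕ #K₁≤#E₁ ⊕ #F₁+κ≤#K₁ ⊕ 1≤κ)
              (lemma (# Sₐ) (# S_b) (# (S C)) (# (E C)) (# F₁) (# E₁) (# K₁) κ))
              where
              lemma : ∀ a b s e f₁ e₁ k κ → 1 + (a + b + (f₁ + (f₁ + (s + e + (e₁ + (k + κ)))))) + κ
                      ≡ a + (s + (b + (e + (e₁ + f₁ + κ + (k + (f₁ + κ + 1))))))
              lemma = solve-∀

            f⁻¹E⊆K₁ : ∀ {e} → e ∈ E C → f ⁻¹ ∙ e ∈ K₁
            f⁻¹E⊆K₁ {e} e∈ with em {f ⁻¹ ∙ e ∈ K₁}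
            ... | yes p = p
            -- Two disjoint cosets would give |Sₐ| + 2|K₁| ≤ |K₁| + |E₁|, against |Sₐ| ≥ |E₁| + κ -
            -- |F₁| and |K₁| ≥ |F₁| + κ.
            ... | no  f⁻¹e∉K₁ = impossible κ
              (≤maximum wide ⊕ proj₂ heaviest ⊕ #cosets ⊕ ≮⇒≥ (disjoint-cosets ∘ 1≤⇒inhabited (f ◃ K₁ ∩ e ◃ K₁))
                ⊕ #S≤#Sₐ+#S_b ⊕ #S_b≤#F₁ ⊕ #E≤#F₁ ⊕ #E₁+#F₁+κ≤ ⊕ #F₁+κ≤#K₁ ⊕ 1≤κ)
              (lemma (# Sₐ) (# S_b) (# (S C)) (# (E C)) (# F₁) (# E₁) (# K₁) κ maximum
                     (# (f ◃ K₁ ∩ e ◃ K₁)) (# (f ◃ K₁ ∪ e ◃ K₁)))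
              where
              coset : ∀ {s y} → s ∈ Sₐ → y ∈ E C → ∀ {x} → x ∈ y ◃ K₁ → s ⁻¹ ∙ x ∈ F
              coset {s} {y} s∈ y∈ {x} x∈ = E₁⊆F (∈-resp E₁ (quotient-trans s y x) (E₁K₁⊆E₁ (near s∈ y∈) (◃⁻ y K₁ x∈)))
              wide : Pair
              wide = record
                { S = Sₐ ; E = f ◃ K₁ ∪ e ◃ K₁
                ; S⊆K = λ s∈ → S⊆K C (proj₁ (Sₐ⁻ s∈))
                ; S≠∅ = Sₐ≠∅
                ; E≠∅ = f ∙ ε , ∪⁺ˡ (f ◃ K₁) (e ◃ K₁) (◃⁺ f K₁ ε∈K₁)
                ; quotient = λ s∈ x∈ → [ coset s∈ f∈E , coset s∈ e∈ ] (∪⁻ (f ◃ K₁) (e ◃ K₁) x∈)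
                }
              disjoint-cosets : ¬ Inhabited (f ◃ K₁ ∩ e ◃ K₁)
              disjoint-cosets (z , z∈) = let z∈f , z∈e = ∩⁻ (f ◃ K₁) (e ◃ K₁) z∈ in
                f⁻¹e∉K₁ (∈-resp K₁ (quotient-trans f z e)
                  (K₁K₁⊆K₁ (◃⁻ f K₁ z∈f) (quotient-swap K₁ K₁⁻¹⊆K₁ (◃⁻ e K₁ z∈e))))
              #cosets : # K₁ + # K₁ ≤ # (f ◃ K₁ ∩ e ◃ K₁) + # (f ◃ K₁ ∪ e ◃ K₁)
              #cosets = ≤-reflexive (≡.sym (≡.trans (#∩+#∪ (f ◃ K₁) (e ◃ K₁)) (≡.cong₂ _+_ (#◃ f K₁) (#◃ e K₁))))
              lemma : ∀ a b s e f₁ e₁ k κ w i u →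
                1 + (w + (k + e₁ + (i + u + (0 + (a + b + (f₁ + (f₁ + (s + e + (k + κ)))))))))  + κ
                ≡ a + u + (w + (k + k + (i + (s + (b + (e + (e₁ + f₁ + κ + (f₁ + κ + 1))))))))
              lemma = solve-∀

            -- Discarding `Sₐ` costs at most |E₁|, so |F₁| + κ remains. As `f` is outside `E₁`, `ε`
            -- belongs to `S_b`, and it yields f⁻¹ in the new second component.
            flipped : P₁.Cover (# F₁ + κ) (f ⁻¹)
            flipped = record
                { S = f ⁻¹ ◃ E C ; E = f ⁻¹ ◃ S_b
                ; S⊆K = λ x∈ → ∈-resp K₁ (cancelˡ⁻¹ (f ⁻¹) _) (f⁻¹E⊆K₁ (◃⁻ (f ⁻¹) (E C) x∈))
                ; S≠∅ = ε , ε∈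
                ; E≠∅ = f ⁻¹ , f⁻¹∈
                ; quotient = λ x∈ y∈ → ∈-resp F₁ (quotient-shift (f ⁻¹ ⁻¹) _ _)
                    (quotient-swap F₁ F₁⁻¹ (far (◃⁻ (f ⁻¹) S_b y∈) (◃⁻ (f ⁻¹) (E C) x∈)))
                } , (ε∈ , f⁻¹∈) , linear 0
                (#S≤#Sₐ+#S_b ⊕ #Sₐ≤#E₁ ⊕ #E₁+#F₁+κ≤
                  ⊕ ≤-reflexive (≡.sym (#◃ (f ⁻¹) (E C))) ⊕ ≤-reflexive (≡.sym (#◃ (f ⁻¹) S_b)))
                (lemma (# Sₐ) (# S_b) (# (S C)) (# (E C)) (# F₁) (# E₁) κ (# (f ⁻¹ ◃ E C)) (# (f ⁻¹ ◃ S_b)))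
              where
              ε∈ : ε ∈ f ⁻¹ ◃ E C
              ε∈ = ∈-resp (f ⁻¹ ◃ E C) (inverseˡ f) (◃⁺ (f ⁻¹) (E C) f∈E)
              f⁻¹∈ : f ⁻¹ ∈ f ⁻¹ ◃ S_b
              f⁻¹∈ = ∈-resp (f ⁻¹ ◃ S_b) (identityʳ (f ⁻¹)) (◃⁺ (f ⁻¹) S_b
                (sift⁺ (S C) (¬-resp near-resp) ε∈S (λ ε-near → proj₂ (F₁⁻ f∈F₁) (∈-resp E₁ (ε⁻¹∙ f) ε-near))))
              -- Otherwise s⁻¹f = (s⁻¹e)(e⁻¹f) would lie in E₁K₁ ⊆ E₁.
              far : ∀ {s e} → s ∈ S_b → e ∈ E C → s ⁻¹ ∙ e ∈ F₁
              far {s} {e} s∈ e∈ = F₁⁺ (quotient C (proj₁ (S_b⁻ s∈)) e∈) λ s⁻¹e∈E₁ → proj₂ (S_b⁻ s∈)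
                (∈-resp E₁ (quotient-trans s e f) (E₁K₁⊆E₁ s⁻¹e∈E₁ (quotient-swap K₁ K₁⁻¹⊆K₁ (f⁻¹E⊆K₁ e∈))))
              lemma : ∀ a b s e f₁ e₁ κ e′ b′ → f₁ + κ + (a + b + (e₁ + (s + e + (e′ + b′)))) + 0
                      ≡ e′ + b′ + (s + (a + (e₁ + f₁ + κ + (e + b))))
              lemma = solve-∀

          reduce : P₁.Cover (# F₁ + κ) f ⊎ P₁.Cover (# F₁ + κ) (f ⁻¹)
          reduce with em {Inhabited (E₁ ∩ E C)}
          ... | yes E₁∩E≠∅   = inj₁ (inside E₁∩E≠∅)
          ... | no  disjoint = inj₂ (Outside.flipped disjoint)

        -- Among the covers of `f`, take greatest weight first and then least |E|; these are the
        -- extremal properties that `reduce` needs.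
        cover-reduce : ∀ {f} → f ∈ F₁ → Cover (# F + κ) f → P₁.Cover (# F₁ + κ) f ⊎ P₁.Cover (# F₁ + κ) (f ⁻¹)
        cover-reduce {f} f∈F₁ (C₀ , covers , C₀-heavy) = go
          (argmax em (weight ∘ proj₁) (weight-bounded ∘ proj₁) (C₀ , covers))
          where
          Covering : Set (c ⊔ ℓ)
          Covering = Σ[ Q ∈ Pair ] ε ∈ S Q × f ∈ E Q
          go : Σ[ M ∈ Covering ] (∀ (Q : Covering) → weight (proj₁ Q) ≤ weight (proj₁ M)) →
               P₁.Cover (# F₁ + κ) f ⊎ P₁.Cover (# F₁ + κ) (f ⁻¹)
          go (M , heavy) = shortest (argmin em {X = Σ[ Q ∈ Covering ] weight (proj₁ M) ≤ weight (proj₁ Q)}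
                                            (λ ((Q , _) , _) → # (E Q)) (M , ≤-refl))
            where
            shortest : Σ[ C ∈ (Σ[ Q ∈ Covering ] weight (proj₁ M) ≤ weight (proj₁ Q)) ]
                         (∀ (Q : Σ[ Q ∈ Covering ] weight (proj₁ M) ≤ weight (proj₁ Q)) →
                            # (E (proj₁ (proj₁ C))) ≤ # (E (proj₁ (proj₁ Q)))) →
                       P₁.Cover (# F₁ + κ) f ⊎ P₁.Cover (# F₁ + κ) (f ⁻¹)
            shortest (((C , ε∈ , f∈) , M≤C) , short) = reduce f∈F₁ C ε∈ f∈
              (≤-trans C₀-heavy (≤-trans (heavy (C₀ , covers)) M≤C))
              λ Q ε∈Q f∈Q C≤Q → short ((Q , ε∈Q , f∈Q) , ≤-trans M≤C C≤Q)

        covered : Covered κ → P₁.Covered κ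
        covered cover {f} f∈F₁ with cover (proj₁ (F₁⁻ f∈F₁))
        ... | inj₁ C = cover-reduce f∈F₁ C
        ... | inj₂ C with cover-reduce (F₁⁻¹ f∈F₁) C
        ...   | inj₁ D = inj₂ D
        ...   | inj₂ (D , (ε∈ , f∈) , heavy) = inj₁ (D , (ε∈ , ∈-resp (P₁.E D) (⁻¹-involutive f) f∈) , heavy)

  -- The stabiliser of the quotient set

  record Stabiliser (K : Pred Carrier (c ⊔ ℓ)) (F : FinSet) (κ : ℕ) : Set (c ⊔ ℓ) where
    field
      L      : FinSet
      L⊆K    : ∀ {x} → x ∈ L → K x
      LF⊆F   : ∀ {x y} → x ∈ L → y ∈ F → x ∙ y ∈ F
      κ≤#L   : κ ≤ # L

  -- Induction on a bound for |F|: a heaviest pair splits off the inhabited set `E₁`. The set found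
  -- for `F₁` lies in `K₁` and so preserves `E₁` too; if nothing remains, `K₁` itself serves.
  covered⇒stabiliser : ∀ n (K : Pred Carrier (c ⊔ ℓ)) (K≤ : IsSubgroup K) (F : FinSet) → Symmetric F →
    # F ≤ n → Inhabited F → ∀ {κ} → 1 ≤ κ → Pairs.Covered K K≤ F κ → Stabiliser K F κ
  covered⇒stabiliser zero K K≤ F _ #F≤0 F≠∅ _ _ = impossible 0 (inhabited⇒1≤ F F≠∅ ⊕ #F≤0) (lemma (# F))
    where
    lemma : ∀ f → 1 + (f + 0) + 0 ≡ 1 + f
    lemma = solve-∀
  covered⇒stabiliser (suc n) K K≤ F F⁻¹ #F≤1+n (f , f∈F) {κ} 1≤κ cover = from-maximum
    (argmax em weight weight-bounded (proj₁ some-heavy)) 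
    where
    open Pairs K K≤ F
    some-heavy : Σ[ P ∈ Pair ] # F + κ ≤ weight P
    some-heavy = [ (λ (P , _ , heavy) → P , heavy) , (λ (P , _ , heavy) → P , heavy) ]′ (cover f∈F)
    from-maximum : (Σ[ P ∈ Pair ] ∀ Q → weight Q ≤ weight P) → Stabiliser K F κ
    from-maximum (P , heaviest) = conclude (period (P , ≤-refl))
      where
      #F+κ≤ : # F + κ ≤ weight P
      #F+κ≤ = ≤-trans (proj₂ some-heavy) (heaviest (proj₁ some-heavy))
      #F< : # F < weight P
      #F< = ≤-trans (≤-trans (≤-reflexive (+-comm 1 (# F))) (+-monoʳ-≤ (# F) 1≤κ)) #F+κ≤
      open Heaviest F⁻¹ (weight P) heaviest #F<
      conclude : Period → Stabiliser K F κ
      conclude Π = by-cases em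
        where
        open Period Π hiding (heaviest)
        open Descend.Along K K≤ F F⁻¹ (weight P) heaviest #F< Π κ 1≤κ #F+κ≤
        by-cases : Dec (Inhabited F₁) → Stabiliser K F κ
        by-cases (no F₁=∅) = record
          { L = K₁
          ; L⊆K = S⊆K B
          ; LF⊆F = λ x∈ y∈ → E₁⊆F (K₁E₁⊆E₁ x∈ (decidable-stable em λ y∉E₁ → F₁=∅ (_ , F₁⁺ y∈ y∉E₁)))
          ; κ≤#L = ≤-trans (m≤n+m κ (# F₁)) #F₁+κ≤#K₁
          }
        by-cases (yes F₁≠∅) = record
          { L = L
          ; L⊆K = λ x∈ → S⊆K B (L⊆K x∈)
          ; LF⊆F = λ x∈ y∈ → act x∈ y∈ em
          ; κ≤#L = κ≤#L
          }
          where
          lemma : ∀ f₁ f e n → f₁ + (f + (1 + n + e)) + 0 ≡ n + (e + f₁ + (f + 1))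
          lemma = solve-∀
          open Stabiliser (covered⇒stabiliser n (_∈ K₁) K₁≤ F₁ F₁⁻¹
            (linear 0 (#F≥ ⊕ #F≤1+n ⊕ inhabited⇒1≤ E₁ (E≠∅ B)) (lemma (# F₁) (# F) (# E₁) n))
            F₁≠∅ 1≤κ (covered cover))
          act : ∀ {x y} → x ∈ L → y ∈ F → Dec (y ∈ E₁) → x ∙ y ∈ F
          act x∈ y∈ (yes y∈E₁) = E₁⊆F (K₁E₁⊆E₁ (L⊆K x∈) y∈E₁)
          act x∈ y∈ (no  y∉E₁) = proj₁ (F₁⁻ (LF⊆F x∈ (F₁⁺ y∈ y∉E₁)))

  -- Product sets and the quotient set A⁻¹A.

  ⋃ : List Carrier → (Carrier → FinSet) → FinSet
  ⋃ []       φ = finSet [] []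
  ⋃ (y ∷ ys) φ = φ y ∪ ⋃ ys φ

  ⋃⁻ : ∀ ys φ {x} → x ∈ ⋃ ys φ → Any (λ y → x ∈ φ y) ys
  ⋃⁻ (y ∷ ys) φ x∈ = [ here , there ∘ ⋃⁻ ys φ ]′ (∪⁻ (φ y) (⋃ ys φ) x∈)

  ⋃⁺ : ∀ ys φ {x} → Any (λ y → x ∈ φ y) ys → x ∈ ⋃ ys φ
  ⋃⁺ (y ∷ ys) φ (here x∈)  = ∪⁺ˡ (φ y) (⋃ ys φ) x∈
  ⋃⁺ (y ∷ ys) φ (there x∈) = ∪⁺ʳ (φ y) (⋃ ys φ) (⋃⁺ ys φ x∈)

  infixl 7.5 _⊙_

  abstract

    _⊙_ : FinSet → FinSet → FinSet
    X ⊙ Y = ⋃ (list Y) (X ▹_)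

    ⊙⁺ : ∀ X Y {x y} → x ∈ X → y ∈ Y → x ∙ y ∈ X ⊙ Y
    ⊙⁺ X Y {x} x∈ y∈ = ⋃⁺ (list Y) (X ▹_) (Any.map (λ {z} y≈z → ∈-resp (X ▹ z) (∙-congˡ (sym y≈z)) (▹⁺ X z x∈)) y∈)

    ⊙⁻ : ∀ X Y {z} → z ∈ X ⊙ Y → ∃[ x ] ∃[ y ] x ∈ X × y ∈ Y × z ≈ x ∙ y
    ⊙⁻ X Y z∈ = let y , y∈ , z∈X▹y = Membership.find setoid (⋃⁻ (list Y) (X ▹_) z∈)
                    x , x∈ , z≈xy = ▹⁻ X y z∈X▹y
                in x , y , x∈ , y∈ , z≈xy

  ⊙-mono : ∀ X {Y Z} → Y ⊆ Z → X ⊙ Y ⊆ X ⊙ Z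
  ⊙-mono X {Y} {Z} Y⊆Z z∈ = let x , y , x∈ , y∈ , z≈ = ⊙⁻ X Y z∈ in ∈-resp (X ⊙ Z) (sym z≈) (⊙⁺ X Z x∈ (Y⊆Z y∈))

  record QuotientSet (A Q : FinSet) : Set (c ⊔ ℓ) where
    field
      A⁻¹A⊆Q : ∀ {a b} → a ∈ A → b ∈ A → a ⁻¹ ∙ b ∈ Q
      Q⊆A⁻¹A : ∀ {x} → x ∈ Q → ∃[ a ] ∃[ b ] a ∈ A × b ∈ A × x ≈ a ⁻¹ ∙ b

    Q⁻¹⊆Q : Symmetric Q
    Q⁻¹⊆Q x∈ = let a , b , a∈ , b∈ , x≈ = Q⊆A⁻¹A x∈ in
      ∈-resp Q (sym (trans (⁻¹-cong x≈) (⁻¹-quotient a b))) (A⁻¹A⊆Q b∈ a∈)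

    ε∈Q : Inhabited A → ε ∈ Q
    ε∈Q (a , a∈) = ∈-resp Q (inverseˡ a) (A⁻¹A⊆Q a∈ a∈)

  Full : Pred Carrier (c ⊔ ℓ)
  Full _ = Lift (c ⊔ ℓ) ⊤

  Full≤ : IsSubgroup Full
  Full≤ = record { resp-≈ = λ _ _ → _ ; ε-closed = _ ; ∙-closed = λ _ _ → _ ; ⁻¹-closed = λ _ → _ }

  -- An element a⁻¹b is covered by (a⁻¹A , a⁻¹A), whose weight is 2|A|.
  quotient-stabiliser : ∀ {A Q} → QuotientSet A Q → Inhabited A → ∀ {κ} → 1 ≤ κ → # Q + κ ≤ # A + # A →
                        Stabiliser Full Q κ
  quotient-stabiliser {A} {Q} A⁻¹A A≠∅ {κ} 1≤κ #Q+κ≤ =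
    covered⇒stabiliser (# Q) Full Full≤ Q Q⁻¹⊆Q ≤-refl (ε , ε∈Q A≠∅) 1≤κ covered
    where
    open QuotientSet A⁻¹A
    open Pairs Full Full≤ Q
    covered : Covered κ
    covered x∈ = let a , b , a∈ , b∈ , x≈ = Q⊆A⁻¹A x∈ in inj₁ (record
      { S = a ⁻¹ ◃ A ; E = a ⁻¹ ◃ A
      ; S⊆K = λ _ → _
      ; S≠∅ = _ , ◃⁺ (a ⁻¹) A a∈
      ; E≠∅ = _ , ◃⁺ (a ⁻¹) A a∈
      ; quotient = λ s∈ e∈ → ∈-resp Q (quotient-shift (a ⁻¹ ⁻¹) _ _) (A⁻¹A⊆Q (◃⁻ (a ⁻¹) A s∈) (◃⁻ (a ⁻¹) A e∈))
      }
      , (∈-resp (a ⁻¹ ◃ A) (inverseˡ a) (◃⁺ (a ⁻¹) A a∈) , ∈-resp (a ⁻¹ ◃ A) (sym x≈) (◃⁺ (a ⁻¹) A b∈))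
      , ≤-trans #Q+κ≤ (≤-reflexive (≡.cong₂ _+_ (≡.sym (#◃ (a ⁻¹) A)) (≡.sym (#◃ (a ⁻¹) A)))))

  module SmallQuotient {A Q : FinSet} (A⁻¹A : QuotientSet A Q) (A≠∅ : Inhabited A) (#Q+2≤ : # Q + 2 ≤ # A + # A) where

    open QuotientSet A⁻¹A

    Stabilises : Pred Carrier (c ⊔ ℓ)
    Stabilises g = ∀ {x} → x ∈ Q → g ∙ x ∈ Q

    stabilises-resp : Stabilises Respects _≈_
    stabilises-resp g≈h gQ⊆Q x∈ = ∈-resp Q (∙-congʳ g≈h) (gQ⊆Q x∈)

    -- Searching inside `Q` loses nothing: as ε ∈ Q, whatever stabilises `Q` belongs to it.
    T : FinSet
    T = ⟨ Q ∣ Stabilises ⟩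

    T⁻ : ∀ {t} → t ∈ T → t ∈ Q × Stabilises t
    T⁻ = sift⁻ Q stabilises-resp

    T⁺ : ∀ {t} → Stabilises t → t ∈ T
    T⁺ {t} tQ⊆Q = sift⁺ Q stabilises-resp (∈-resp Q (identityʳ t) (tQ⊆Q (ε∈Q A≠∅))) tQ⊆Q

    ε∈T : ε ∈ T
    ε∈T = T⁺ λ {x} x∈ → ∈-resp Q (sym (identityˡ x)) x∈

    T⁻¹⊆T : Symmetric T
    T⁻¹⊆T {t} t∈ = T⁺ λ x∈ → ◃⁻ t Q (⊆∧≥⇒⊇ (t ◃ Q) Q
      (λ y∈ → ∈-resp Q (cancelˡ⁻¹ t _) (proj₂ (T⁻ t∈) (◃⁻ t Q y∈))) (≤-reflexive (≡.sym (#◃ t Q)))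
      x∈)

    -- Left invariance becomes right invariance on taking inverses, since `Q` and `T` are symmetric.
    QT⊆Q : ∀ {x t} → x ∈ Q → t ∈ T → x ∙ t ∈ Q
    QT⊆Q {x} {t} x∈ t∈ = ∈-resp Q
      (trans (⁻¹-anti-homo-∙ (t ⁻¹) (x ⁻¹)) (∙-cong (⁻¹-involutive x) (⁻¹-involutive t)))
      (Q⁻¹⊆Q (proj₂ (T⁻ (T⁻¹⊆T t∈)) (Q⁻¹⊆Q x∈)))

    A⊆AT : A ⊆ A ⊙ T
    A⊆AT {a} a∈ = ∈-resp (A ⊙ T) (identityʳ a) (⊙⁺ A T a∈ ε∈T)

    AT-quotient : QuotientSet (A ⊙ T) Q
    AT-quotient = record
      { A⁻¹A⊆Q = λ x∈ y∈ →
          let a , t , a∈ , t∈ , x≈ = ⊙⁻ A T x∈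
              b , u , b∈ , u∈ , y≈ = ⊙⁻ A T y∈
          in ∈-resp Q (eq x≈ y≈) (QT⊆Q (proj₂ (T⁻ (T⁻¹⊆T t∈)) (A⁻¹A⊆Q a∈ b∈)) u∈)
      ; Q⊆A⁻¹A = λ x∈ → let a , b , a∈ , b∈ , x≈ = Q⊆A⁻¹A x∈ in a , b , A⊆AT a∈ , A⊆AT b∈ , x≈
      }
      where
      eq : ∀ {x y a t b u} → x ≈ a ∙ t → y ≈ b ∙ u → t ⁻¹ ∙ (a ⁻¹ ∙ b) ∙ u ≈ x ⁻¹ ∙ y
      eq {x} {y} {a} {t} {b} {u} x≈ y≈ = begin
        t ⁻¹ ∙ (a ⁻¹ ∙ b) ∙ u     ≈⟨ ∙-congʳ (assoc _ _ _) ⟨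
        t ⁻¹ ∙ a ⁻¹ ∙ b ∙ u       ≈⟨ assoc _ _ _ ⟩
        t ⁻¹ ∙ a ⁻¹ ∙ (b ∙ u)     ≈⟨ ∙-cong (trans (⁻¹-cong x≈) (⁻¹-anti-homo-∙ a t)) y≈ ⟨
        x ⁻¹ ∙ y                  ∎

    ≤#T : ∀ {κ} → Stabiliser Full Q κ → κ ≤ # T
    ≤#T 𝓛 = ≤-trans κ≤#L (⊆⇒≤ L T (λ l∈ → T⁺ (LF⊆F l∈)))
      where open Stabiliser 𝓛

    -- The Kneser-type inequality for AT, whose quotient set is again `Q`, with κ = 2|AT| - |Q|.
    -- This difference is at least 2, so the truncated subtraction is exact.
    2#AT≤ : # (A ⊙ T) + # (A ⊙ T) ≤ # Q + # T
    2#AT≤ = ≤-trans (m≤n+m∸n (# (A ⊙ T) + # (A ⊙ T)) (# Q)) (+-monoʳ-≤ (# Q) (≤#T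
      (quotient-stabiliser AT-quotient (_ , A⊆AT (proj₂ A≠∅))
        (m+n≤o⇒n≤o∸m′ (≤-trans (+-monoʳ-≤ (# Q) (s≤s z≤n)) #Q+2≤2#AT))
        (≤-reflexive (m+[n∸m]≡n (≤-trans (m≤m+n (# Q) 2) #Q+2≤2#AT))))))
      where
      #Q+2≤2#AT : # Q + 2 ≤ # (A ⊙ T) + # (A ⊙ T)
      #Q+2≤2#AT = ≤-trans #Q+2≤ (⊆⇒≤ A (A ⊙ T) A⊆AT ⊕ ⊆⇒≤ A (A ⊙ T) A⊆AT)
      m+n≤o⇒n≤o∸m′ : ∀ {m n o} → m + n ≤ o → n ≤ o ∸ m
      m+n≤o⇒n≤o∸m′ {m} {n} {o} m+n≤o = m+n≤o⇒m≤o∸n n (≤-trans (≤-reflexive (+-comm n m)) m+n≤o)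

    -- If |A| + |T| ≤ |AT| + 1, then doubling and inserting 2|AT| ≤ |Q| + |T| and |Q| + 2 ≤ 2|A|
    -- leaves |T| ≤ 0, whereas |T| ≥ 2.
    #AT+2≤ : # (A ⊙ T) + 2 ≤ # A + # T
    #AT+2≤ = ≮⇒≥ λ #A+#T< → impossible 1
      (#A+#T< ⊕ #A+#T< ⊕ 2#AT≤ ⊕ #Q+2≤ ⊕ ≤#T (quotient-stabiliser A⁻¹A A≠∅ (s≤s z≤n) #Q+2≤))
      (lemma (# A) (# T) (# (A ⊙ T)) (# Q))
      where
      lemma : ∀ a t b q → 1 + (b + 2 + (b + 2 + (q + t + (a + a + t)))) + 1
              ≡ suc (a + t) + (suc (a + t) + (b + b + (q + 2 + 2)))
      lemma = solve-∀

  -- Subgroups H minimising |AH| − |H|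

  module Fragments (A : FinSet) (A≠∅ : Inhabited A) (Γ : Pred Carrier (c ⊔ ℓ)) (Γ≤ : IsSubgroup Γ) where

    record Candidate : Set (c ⊔ ℓ) where
      field
        Y   : FinSet
        Y≠∅ : Inhabited Y
        Y⊆Γ : ∀ {y} → y ∈ Y → Γ y

    open Candidate public

    #Y≤#AY : ∀ C → # (Y C) ≤ # (A ⊙ Y C)
    #Y≤#AY C = injection⇒≤ (Y C) (A ⊙ Y C) (proj₁ A≠∅ ∙_) (⊙⁺ A (Y C) (proj₂ A≠∅)) (∙-cancelˡ _ _ _)

    excess : Candidate → ℕ
    excess C = # (A ⊙ Y C) ∸ # (Y C)

    -- An atom in the sense of the isoperimetric method: `η` is the least value of |AY| - |Y| over
    -- the candidates and `H` attains it.
    record Atom : Set (c ⊔ ℓ) where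
      field
        H       : FinSet
        η       : ℕ
        ε∈H     : ε ∈ H
        HH⊆H    : ∀ {x y} → x ∈ H → y ∈ H → x ∙ y ∈ H
        H⁻¹⊆H   : Symmetric H
        H⊆Γ     : ∀ {x} → x ∈ H → Γ x
        #AH≤    : # (A ⊙ H) ≤ # H + η
        minimal : ∀ C → # (Y C) + η ≤ # (A ⊙ Y C)

    module Minimal (η : ℕ) (minimal : ∀ C → # (Y C) + η ≤ # (A ⊙ Y C)) (C : Candidate)
                   (#AY≤ : # (A ⊙ Y C) ≤ # (Y C) + η)
                   (least : ∀ D → # (A ⊙ Y D) ≤ # (Y D) + η → # (Y C) ≤ # (Y D)) where

      #AY▹≤ : ∀ k → # (A ⊙ (Y C ▹ k)) ≤ # (Y C) + η
      #AY▹≤ k = ≤-trans (injection⇒≤ (A ⊙ (Y C ▹ k)) (A ⊙ Y C) (_∙ k ⁻¹)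
          (λ z∈ → let a , x , a∈ , x∈ , z≈ = ⊙⁻ A (Y C ▹ k) z∈
                      y , y∈ , x≈ = ▹⁻ (Y C) k x∈
                  in ∈-resp (A ⊙ Y C) (sym (eq z≈ x≈)) (⊙⁺ A (Y C) a∈ y∈))
          (∙-cancelʳ _ _ _)) #AY≤
        where
        eq : ∀ {z a x y} → z ≈ a ∙ x → x ≈ y ∙ k → z ∙ k ⁻¹ ≈ a ∙ y
        eq {z} {a} {x} {y} z≈ x≈ = begin
          z ∙ k ⁻¹              ≈⟨ ∙-congʳ (trans z≈ (∙-congˡ x≈)) ⟩
          a ∙ (y ∙ k) ∙ k ⁻¹    ≈⟨ ∙-congʳ (assoc _ _ _) ⟨
          a ∙ y ∙ k ∙ k ⁻¹      ≈⟨ //-rightDividesʳ k (a ∙ y) ⟩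
          a ∙ y                 ∎

      y₀ : Carrier
      y₀ = proj₁ (Y≠∅ C)

      -- A translate containing `ε`; translating on the right changes neither |Y| nor |AY|.
      H : FinSet
      H = Y C ▹ y₀ ⁻¹

      #H≡ : # H ≡ # (Y C)
      #H≡ = #▹ (Y C) (y₀ ⁻¹)

      ε∈H : ε ∈ H
      ε∈H = ∈-resp H (inverseʳ y₀) (▹⁺ (Y C) (y₀ ⁻¹) (proj₂ (Y≠∅ C)))

      H⊆Γ : ∀ {x} → x ∈ H → Γ x
      H⊆Γ x∈ = let y , y∈ , x≈ = ▹⁻ (Y C) (y₀ ⁻¹) x∈ in
        resp-≈ Γ≤ (sym x≈) (∙-closed Γ≤ (Y⊆Γ C y∈) (⁻¹-closed Γ≤ (Y⊆Γ C (proj₂ (Y≠∅ C)))))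

      #AH≤ : # (A ⊙ H) ≤ # H + η
      #AH≤ = ≤-trans (#AY▹≤ (y₀ ⁻¹)) (≤-reflexive (≡.cong (_+ η) (≡.sym #H≡)))

      #AH▹≤ : ∀ k → # (A ⊙ (H ▹ k)) ≤ # H + η
      #AH▹≤ k = ≤-trans (⊆⇒≤ (A ⊙ (H ▹ k)) (A ⊙ (Y C ▹ (y₀ ⁻¹ ∙ k))) (⊙-mono A λ x∈ →
                  let h , h∈ , x≈ = ▹⁻ H k x∈
                      y , y∈ , h≈ = ▹⁻ (Y C) (y₀ ⁻¹) h∈
                  in ∈-resp (Y C ▹ (y₀ ⁻¹ ∙ k)) (sym (trans x≈ (trans (∙-congʳ h≈) (assoc _ _ _))))
                            (▹⁺ (Y C) (y₀ ⁻¹ ∙ k) y∈)))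
                (≤-trans (#AY▹≤ (y₀ ⁻¹ ∙ k)) (≤-reflexive (≡.cong (_+ η) (≡.sym #H≡))))

      module _ {y} (y∈H : y ∈ H) where

        H′ : FinSet
        H′ = H ▹ y ⁻¹

        H′⊆Γ : ∀ {x} → x ∈ H′ → Γ x
        H′⊆Γ x∈ = let h , h∈ , x≈ = ▹⁻ H (y ⁻¹) x∈ in
          resp-≈ Γ≤ (sym x≈) (∙-closed Γ≤ (H⊆Γ h∈) (⁻¹-closed Γ≤ (H⊆Γ y∈H)))

        ε∈H′ : ε ∈ H′
        ε∈H′ = ∈-resp H′ (inverseʳ y) (▹⁺ H (y ⁻¹) y∈H)

        C∩ C∪ : Candidate
        C∩ = record { Y = H ∩ H′ ; Y≠∅ = ε , ∩⁺ H H′ ε∈H ε∈H′ ; Y⊆Γ = λ x∈ → H⊆Γ (proj₁ (∩⁻ H H′ x∈)) }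
        C∪ = record { Y = H ∪ H′ ; Y≠∅ = ε , ∪⁺ˡ H H′ ε∈H ; Y⊆Γ = λ x∈ → [ H⊆Γ , H′⊆Γ ] (∪⁻ H H′ x∈) }

        #AH∩≤ : # (A ⊙ (H ∩ H′)) ≤ # (A ⊙ H ∩ A ⊙ H′)
        #AH∩≤ = ⊆⇒≤ (A ⊙ (H ∩ H′)) (A ⊙ H ∩ A ⊙ H′) λ z∈ → ∩⁺ (A ⊙ H) (A ⊙ H′)
          (⊙-mono A (λ x∈ → proj₁ (∩⁻ H H′ x∈)) z∈) (⊙-mono A (λ x∈ → proj₂ (∩⁻ H H′ x∈)) z∈)

        #AH∪≤ : # (A ⊙ (H ∪ H′)) ≤ # (A ⊙ H ∪ A ⊙ H′)
        #AH∪≤ = ⊆⇒≤ (A ⊙ (H ∪ H′)) (A ⊙ H ∪ A ⊙ H′) λ z∈ →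
          let a , x , a∈ , x∈ , z≈ = ⊙⁻ A (H ∪ H′) z∈ in
          [ (λ x∈H → ∪⁺ˡ (A ⊙ H) (A ⊙ H′) (∈-resp (A ⊙ H) (sym z≈) (⊙⁺ A H a∈ x∈H)))
          , (λ x∈H′ → ∪⁺ʳ (A ⊙ H) (A ⊙ H′) (∈-resp (A ⊙ H′) (sym z≈) (⊙⁺ A H′ a∈ x∈H′)))
          ] (∪⁻ H H′ x∈)

        -- Submodularity: A(H ∩ H′) ⊆ AH ∩ AH′ and A(H ∪ H′) ⊆ AH ∪ AH′. The union has excess at
        -- least `η`, so the intersection has excess at most `η`, and by `least` it is not smaller
        -- than `H`.
        H⊆H′ : H ⊆ H′
        H⊆H′ x∈ = proj₂ (∩⁻ H H′ (⊆∧≥⇒⊇ (H ∩ H′) H (λ x∈ → proj₁ (∩⁻ H H′ x∈))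
          (≤-trans (≤-reflexive #H≡) (least C∩ (linear 0
            (#AH∩≤ ⊕ #AH∪≤ ⊕ ≤-reflexive (#∩+#∪ (A ⊙ H) (A ⊙ H′)) ⊕ #AH≤ ⊕ #AH▹≤ (y ⁻¹) ⊕ minimal C∪
              ⊕ ≤-reflexive (≡.trans (≡.cong (# H +_) (≡.sym (#▹ H (y ⁻¹)))) (≡.sym (#∩+#∪ H H′))))
            (lemma (# (A ⊙ (H ∩ H′))) (# (A ⊙ (H ∪ H′))) (# (A ⊙ H ∩ A ⊙ H′)) (# (A ⊙ H ∪ A ⊙ H′))
                   (# (A ⊙ H)) (# (A ⊙ H′)) (# H) (# (H ∩ H′)) (# (H ∪ H′)) η)))) x∈))
          where
          lemma : ∀ i u i′ u′ a a′ h n m η →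
            i + (i′ + (u′ + (a + a′ + (h + η + (h + η + (u + (n + m))))))) + 0
            ≡ n + η + (i + (u + (i′ + u′ + (a + (a′ + (m + η + (h + h)))))))
          lemma = solve-∀

      HH⊆H : ∀ {x y} → x ∈ H → y ∈ H → x ∙ y ∈ H
      HH⊆H {x} {y} x∈ y∈ = let h , h∈ , x≈ = ▹⁻ H (y ⁻¹) (H⊆H′ y∈ x∈) in
        ∈-resp H (sym (trans (∙-congʳ x≈) (//-rightDividesˡ y h))) h∈

      H⁻¹⊆H : Symmetric H
      H⁻¹⊆H {y} y∈ = ⊆∧≥⇒⊇ H (H′ y∈) (H⊆H′ y∈) (≤-reflexive (#▹ H (y ⁻¹)))
        (∈-resp (H′ y∈) (identityˡ (y ⁻¹)) (▹⁺ H (y ⁻¹) ε∈H))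

      atom : Atom
      atom = record
        { H = H ; η = η ; ε∈H = ε∈H ; HH⊆H = HH⊆H ; H⁻¹⊆H = H⁻¹⊆H ; H⊆Γ = H⊆Γ ; #AH≤ = #AH≤ ; minimal = minimal }

    abstract

      atom : Atom
      atom = least-excess (argmin em excess trivial)
        where
        trivial : Candidate
        trivial = record
          { Y = ｛ ε ｝ ; Y≠∅ = ε , here refl
          ; Y⊆Γ = λ { (here x≈ε) → resp-≈ Γ≤ (sym x≈ε) (ε-closed Γ≤) } }
        least-excess : (Σ[ C ∈ Candidate ] ∀ D → excess C ≤ excess D) → Atom
        least-excess (C , least) = least-size (argmin em {X = Σ[ D ∈ Candidate ] # (A ⊙ Y D) ≤ # (Y D) + excess C}
            (λ (D , _) → # (Y D)) (C , ≤-reflexive (≡.sym (m+[n∸m]≡n (#Y≤#AY C)))))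
          where
          least-size : (Σ[ (D , _) ∈ (Σ[ D ∈ Candidate ] # (A ⊙ Y D) ≤ # (Y D) + excess C) ]
                          ∀ ((E , _) : Σ[ D ∈ Candidate ] # (A ⊙ Y D) ≤ # (Y D) + excess C) → # (Y D) ≤ # (Y E)) → Atom
          least-size ((D , #AD≤) , small) = Minimal.atom (excess C)
            (λ E → ≤-trans (+-monoʳ-≤ (# (Y E)) (least E)) (≤-reflexive (m+[n∸m]≡n (#Y≤#AY E))))
            D #AD≤ (λ E #AE≤ → small (E , #AE≤))

  -- The atom of a set with small quotient set.

  module SmallQuotientAtom {A Q : FinSet} (A⁻¹A : QuotientSet A Q) (A≠∅ : Inhabited A) (#Q+2≤ : # Q + 2 ≤ # A + # A)
                           (Γ : Pred Carrier (c ⊔ ℓ)) (Γ≤ : IsSubgroup Γ) (Q⊆Γ : ∀ {x} → x ∈ Q → Γ x)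
                           (atom₀ : Fragments.Atom A A≠∅ Γ Γ≤) where

    open QuotientSet A⁻¹A
    open SmallQuotient A⁻¹A A≠∅ #Q+2≤ using (T; T⁻; ε∈T; #AT+2≤)
    open Fragments A A≠∅ Γ Γ≤ using (Candidate; Atom)
    open Atom atom₀ public

    -- `T` lies in Q ⊆ Γ and competes in the minimum: |T| + η ≤ |AT| ≤ |A| + |T| - 2.
    η+2≤#A : η + 2 ≤ # A
    η+2≤#A = linear 0 (minimal stabiliser ⊕ #AT+2≤) (lemma η (# A) (# T) (# (A ⊙ T)))
      where
      stabiliser : Candidate
      stabiliser = record { Y = T ; Y≠∅ = ε , ε∈T ; Y⊆Γ = λ t∈ → Q⊆Γ (proj₁ (T⁻ t∈)) }
      lemma : ∀ η a t b → η + 2 + (b + (a + t)) + 0 ≡ a + (t + η + (b + 2))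
      lemma = solve-∀

    A⊆AH : A ⊆ A ⊙ H
    A⊆AH {a} a∈ = ∈-resp (A ⊙ H) (identityʳ a) (⊙⁺ A H a∈ ε∈H)

    -- Otherwise |A| ≤ |AH| ≤ 1 + η ≤ |A| - 1.
    H-nontrivial : ¬ (∀ {x} → x ∈ H → x ≈ ε)
    H-nontrivial H≈ε = impossible 0
      (⊆⇒≤ H ｛ ε ｝ (λ x∈ → here (H≈ε x∈)) ⊕ ⊆⇒≤ A (A ⊙ H) A⊆AH ⊕ #AH≤ ⊕ η+2≤#A) (lemma (# H) (# A) (# (A ⊙ H)) η)
      where
      lemma : ∀ h a b η → 1 + (1 + (b + (h + η + a))) + 0 ≡ h + (a + (b + (η + 2)))
      lemma = solve-∀

    A⁻¹ : FinSet
    A⁻¹ = image _⁻¹ (⁻¹-cong , ⁻¹-injective) A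

    A⁻¹⁺ : ∀ {a} → a ∈ A → a ⁻¹ ∈ A⁻¹
    A⁻¹⁺ = image⁺ _⁻¹ (⁻¹-cong , ⁻¹-injective) A

    A⁻¹⁻ : ∀ {x} → x ∈ A⁻¹ → ∃[ a ] a ∈ A × x ≈ a ⁻¹
    A⁻¹⁻ = image⁻ _⁻¹ (⁻¹-cong , ⁻¹-injective) A

    -- Minimality is applied to A⁻¹a₀: the factor `a₀` brings A⁻¹ into A⁻¹A ⊆ Γ and does not change
    -- |AA⁻¹|.
    #AA⁻¹≥ : # A + η ≤ # (A ⊙ A⁻¹)
    #AA⁻¹≥ = ≤-trans (+-monoˡ-≤ η (≤-reflexive (≡.sym (#◂ A a₀)))) (≤-trans (minimal A⁻¹a₀)
        (injection⇒≤ (A ⊙ (A ◂ a₀)) (A ⊙ A⁻¹) (_∙ a₀ ⁻¹)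
          (λ z∈ → let a , x , a∈ , x∈ , z≈ = ⊙⁻ A (A ◂ a₀) z∈
                      b , b∈ , x≈ = ◂⁻ A a₀ x∈
                  in ∈-resp (A ⊙ A⁻¹) (sym (eq z≈ x≈)) (⊙⁺ A A⁻¹ a∈ (A⁻¹⁺ b∈)))
          (proj₂ (∙ʳ-injection (a₀ ⁻¹)))))
      where
      a₀ : Carrier
      a₀ = proj₁ A≠∅
      A⁻¹a₀ : Candidate
      A⁻¹a₀ = record
        { Y = A ◂ a₀ ; Y≠∅ = _ , ◂⁺ A a₀ (proj₂ A≠∅)
        ; Y⊆Γ = λ x∈ → let b , b∈ , x≈ = ◂⁻ A a₀ x∈ in
            resp-≈ Γ≤ (sym x≈) (Q⊆Γ (A⁻¹A⊆Q b∈ (proj₂ A≠∅))) }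
      eq : ∀ {z a x b} → z ≈ a ∙ x → x ≈ b ⁻¹ ∙ a₀ → z ∙ a₀ ⁻¹ ≈ a ∙ b ⁻¹
      eq {z} {a} {x} {b} z≈ x≈ = begin
        z ∙ a₀ ⁻¹                     ≈⟨ ∙-congʳ (trans z≈ (∙-congˡ x≈)) ⟩
        a ∙ (b ⁻¹ ∙ a₀) ∙ a₀ ⁻¹       ≈⟨ ∙-congʳ (assoc _ _ _) ⟨
        a ∙ b ⁻¹ ∙ a₀ ∙ a₀ ⁻¹         ≈⟨ //-rightDividesʳ a₀ (a ∙ b ⁻¹) ⟩
        a ∙ b ⁻¹                      ∎

    -- 2|AH| ≤ 2|H| + 2η, while |AA⁻¹| ≥ |A| + η ≥ 2η + 2.
    2#AH< : # (A ⊙ H) + # (A ⊙ H) < # (A ⊙ A⁻¹) + (# H + # H)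
    2#AH< = linear 1 (#AH≤ ⊕ #AH≤ ⊕ #AA⁻¹≥ ⊕ η+2≤#A) (lemma (# (A ⊙ H)) (# H) η (# A) (# (A ⊙ A⁻¹)))
      where
      lemma : ∀ b h η a k → suc (b + b) + (h + η + (h + η + (k + a))) + 1
              ≡ k + (h + h) + (b + (b + (a + η + (η + 2))))
      lemma = solve-∀

    Into : Carrier → Pred Carrier (c ⊔ ℓ)
    Into x h = x ∙ h ∈ A

    into-resp : ∀ x → Into x Respects _≈_
    into-resp x h≈k = ∈-resp A (∙-congˡ h≈k)

    -- in-A x and out-A x are the translates to H of A ∩ xH and xH ∖ A.
    in-A out-A : Carrier → FinSet
    in-A  x = ⟨ H ∣ Into x ⟩
    out-A x = ⟨ H ∣ (λ h → ¬ Into x h) ⟩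

    #H≤in+out : ∀ x → # H ≤ # (in-A x) + # (out-A x)
    #H≤in+out x = ≤-reflexive (≡.sym (#sift H (Into x)))

    -- The gaps of `A` in xH and in yH are disjoint, and AH has at most |H| + η - |A| ≤ |H| - 2
    -- elements outside `A`.
    distinct-cosets : ∀ {x y} → x ∈ A → y ∈ A → x ⁻¹ ∙ y ∉ H → # H < # (in-A x) + # (in-A y)
    distinct-cosets {x} {y} x∈ y∈ x⁻¹y∉H = linear 1
      (#H≤in+out x ⊕ #H≤in+out y ⊕ #out ⊕ ≮⇒≥ (disjoint ∘ 1≤⇒inhabited (xOut ∩ yOut)) ⊕ ⊆⇒≤ (xOut ∪ yOut) (A ⊙ H ∖ A) ∪⊆
        ⊕ ≤-reflexive (#∩+#∖ (A ⊙ H) A) ⊕ ⊆⇒≤ A (A ⊙ H ∩ A) (λ a∈ → ∩⁺ (A ⊙ H) A (A⊆AH a∈) a∈) ⊕ #AH≤ ⊕ η+2≤#A)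
      (lemma (# H) (# (in-A x)) (# (out-A x)) (# (in-A y)) (# (out-A y)) (# (xOut ∩ yOut)) (# (xOut ∪ yOut))
             (# (A ⊙ H ∖ A)) (# (A ⊙ H ∩ A)) (# (A ⊙ H)) (# A) η)
      where
      xOut yOut : FinSet
      xOut = x ◃ out-A x
      yOut = y ◃ out-A y
      out⁻ : ∀ z {w} → w ∈ z ◃ out-A z → z ⁻¹ ∙ w ∈ H × w ∉ A
      out⁻ z w∈ = let h∈ , zh∉ = sift⁻ H (¬-resp (into-resp z)) (◃⁻ z (out-A z) w∈) in
        h∈ , λ w∈A → zh∉ (∈-resp A (sym (cancelˡ⁻¹ z _)) w∈A)
      #out : # (out-A x) + # (out-A y) ≤ # (xOut ∩ yOut) + # (xOut ∪ yOut)
      #out = ≤-reflexive (≡.sym (≡.trans (#∩+#∪ xOut yOut) (≡.cong₂ _+_ (#◃ x (out-A x)) (#◃ y (out-A y)))))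
      disjoint : ¬ Inhabited (xOut ∩ yOut)
      disjoint (z , z∈) = let z∈x , z∈y = ∩⁻ xOut yOut z∈ in
        x⁻¹y∉H (∈-resp H (quotient-trans x z y) (HH⊆H (proj₁ (out⁻ x z∈x)) (quotient-swap H H⁻¹⊆H (proj₁ (out⁻ y z∈y)))))
      out⊆ : ∀ {z} → z ∈ A → z ◃ out-A z ⊆ A ⊙ H ∖ A
      out⊆ {z} z∈ w∈ = let h∈ , w∉ = out⁻ z w∈ in ∖⁺ (A ⊙ H) A (∈-resp (A ⊙ H) (cancelˡ⁻¹ z _) (⊙⁺ A H z∈ h∈)) w∉
      ∪⊆ : xOut ∪ yOut ⊆ A ⊙ H ∖ A
      ∪⊆ w∈ = [ out⊆ x∈ , out⊆ y∈ ]′ (∪⁻ xOut yOut w∈)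
      lemma : ∀ h i o i′ o′ n u d m b a η →
        suc h + (i + o + (i′ + o′ + (n + u + (0 + (d + (b + (m + (h + η + a)))))))) + 1
        ≡ i + i′ + (h + (h + (o + o′ + (n + (u + (m + d + (a + (b + (η + 2)))))))))
      lemma = solve-∀

    -- At most half of the coset aH lies in `A`. By `distinct-cosets`, all such elements of `A`
    -- share one coset.
    Sparse : Carrier → Set (c ⊔ ℓ)
    Sparse a = Lift (c ⊔ ℓ) (# (in-A a) + # (in-A a) ≤ # H)

    sparse-unique : ∀ {a x} → a ∈ A → x ∈ A → Sparse a → Sparse x → a ⁻¹ ∙ x ∈ H
    sparse-unique {a} {x} a∈ x∈ (lift a-sparse) (lift x-sparse) = decidable-stable em λ a⁻¹x∉H →
      impossible 1 (a-sparse ⊕ x-sparse ⊕ distinct-cosets a∈ x∈ a⁻¹x∉H ⊕ distinct-cosets a∈ x∈ a⁻¹x∉H)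
                   (lemma (# (in-A a)) (# (in-A x)) (# H))
      where
      lemma : ∀ i j h → 1 + (h + (h + (i + j + (i + j)))) + 1 ≡ i + i + (j + j + (suc h + suc h))
      lemma = solve-∀

    -- Take a sparse element if there is one, and any element of `A` otherwise.
    sparsest : Σ[ a ∈ Carrier ] a ∈ A × (∀ {x} → x ∈ A → a ⁻¹ ∙ x ∉ H → ¬ Sparse x)
    sparsest with em {Σ[ a ∈ Carrier ] a ∈ A × Sparse a}
    ... | yes (a , a∈ , a-sparse) = a , a∈ , λ x∈ a⁻¹x∉H x-sparse → a⁻¹x∉H (sparse-unique a∈ x∈ a-sparse x-sparse)
    ... | no  no-sparse = proj₁ A≠∅ , proj₂ A≠∅ , λ x∈ _ x-sparse → no-sparse (_ , x∈ , x-sparse)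

    a : Carrier
    a = proj₁ sparsest

    a∈A : a ∈ A
    a∈A = proj₁ (proj₂ sparsest)

    -- If x and y share a coset of `H`, it is not aH, so neither is sparse. Were the inequality
    -- false, the one with the smaller `in-A` would be sparse.
    dense : ∀ {x y} → x ∈ A → y ∈ A → ¬ (a ⁻¹ ∙ x ∈ H × a ⁻¹ ∙ y ∈ H) → # H < # (in-A x) + # (in-A y)
    dense {x} {y} x∈ y∈ not-both with em {x ⁻¹ ∙ y ∈ H}
    ... | no  x⁻¹y∉H = distinct-cosets x∈ y∈ x⁻¹y∉H
    ... | yes x⁻¹y∈H = ≰⇒> λ in≤H → [ not-sparse x∈ x∉ , not-sparse y∈ y∉ ]′ (smaller in≤H)
      where
      not-sparse : ∀ {z} → z ∈ A → a ⁻¹ ∙ z ∉ H → ¬ Sparse z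
      not-sparse = proj₂ (proj₂ sparsest)
      x∉ : a ⁻¹ ∙ x ∉ H
      x∉ x∈H = not-both (x∈H , ∈-resp H (quotient-trans a x y) (HH⊆H x∈H x⁻¹y∈H))
      y∉ : a ⁻¹ ∙ y ∉ H
      y∉ y∈H = not-both (∈-resp H (quotient-trans a y x) (HH⊆H y∈H (quotient-swap H H⁻¹⊆H x⁻¹y∈H)) , y∈H)
      smaller : # (in-A x) + # (in-A y) ≤ # H → Sparse x ⊎ Sparse y
      smaller in≤H with ≤-total (# (in-A x)) (# (in-A y))
      ... | inj₁ x≤y = inj₁ (lift (≤-trans (+-monoʳ-≤ (# (in-A x)) x≤y) in≤H))
      ... | inj₂ y≤x = inj₂ (lift (≤-trans (+-monoˡ-≤ (# (in-A y)) y≤x) in≤H))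

    -- `in-A x` and `h ◃ in-A y` lie in `H` and are too large to be disjoint. A common `l` has xl
    -- and yh⁻¹l in `A`, and (xl)(yh⁻¹l)⁻¹ = xhy⁻¹.
    xHy⁻¹⊆AA⁻¹ : ∀ {x y h} → x ∈ A → y ∈ A → ¬ (a ⁻¹ ∙ x ∈ H × a ⁻¹ ∙ y ∈ H) → h ∈ H →
                 ∃[ u ] ∃[ v ] u ∈ A × v ∈ A × x ∙ h ∙ y ⁻¹ ≈ u ∙ v ⁻¹
    xHy⁻¹⊆AA⁻¹ {x} {y} {h} x∈ y∈ not-both h∈ = x ∙ l , y ∙ (h ⁻¹ ∙ l) ,
      proj₂ (sift⁻ H (into-resp x) (proj₁ l∈)) , proj₂ (sift⁻ H (into-resp y) (◃⁻ h (in-A y) (proj₂ l∈))) , sym eq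
      where
      meeting : Inhabited (in-A x ∩ h ◃ in-A y)
      meeting = pigeonhole (in-A x) (h ◃ in-A y) H (λ l∈ → proj₁ (sift⁻ H (into-resp x) l∈))
        (λ l∈ → ∈-resp H (cancelˡ⁻¹ h _) (HH⊆H h∈ (proj₁ (sift⁻ H (into-resp y) (◃⁻ h (in-A y) l∈)))))
        (≤-trans (dense x∈ y∈ not-both) (≤-reflexive (≡.cong (# (in-A x) +_) (≡.sym (#◃ h (in-A y))))))
      l : Carrier
      l = proj₁ meeting
      l∈ : l ∈ in-A x × l ∈ h ◃ in-A y
      l∈ = ∩⁻ (in-A x) (h ◃ in-A y) (proj₂ meeting)
      eq : x ∙ l ∙ (y ∙ (h ⁻¹ ∙ l)) ⁻¹ ≈ x ∙ h ∙ y ⁻¹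
      eq = begin
        x ∙ l ∙ (y ∙ (h ⁻¹ ∙ l)) ⁻¹        ≈⟨ ∙-congˡ (⁻¹-anti-homo-∙ y _) ⟩
        x ∙ l ∙ ((h ⁻¹ ∙ l) ⁻¹ ∙ y ⁻¹)     ≈⟨ ∙-congˡ (∙-congʳ (⁻¹-quotient h l)) ⟩
        x ∙ l ∙ (l ⁻¹ ∙ h ∙ y ⁻¹)          ≈⟨ assoc _ _ _ ⟩
        x ∙ (l ∙ (l ⁻¹ ∙ h ∙ y ⁻¹))        ≈⟨ ∙-congˡ (∙-congˡ (assoc _ _ _)) ⟩
        x ∙ (l ∙ (l ⁻¹ ∙ (h ∙ y ⁻¹)))      ≈⟨ ∙-congˡ (cancelˡ⁻¹ l _) ⟩
        x ∙ (h ∙ y ⁻¹)                     ≈⟨ assoc _ _ _ ⟨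
        x ∙ h ∙ y ⁻¹                       ∎

  -- Finite predicates and their enumerations.

  open Subsets G₀ using (∣_∣≡_)

  enumerate : {P : Pred Carrier α} → P Respects _≈_ → ∀ {n} → ∣ P ∣≡ n →
              Σ[ X ∈ FinSet ] (∀ {x} → x ∈ X → P x) × (∀ {x} → P x → x ∈ X) × # X ≡ n
  enumerate {P = P} resp {n} ∣P∣≡n = X
    , (λ x∈ → let i , x≈ = ∈-tabulate⁻ setoid x∈ in resp (sym x≈) (proj₂ (to i)))
    , (λ {x} Px → let i , i↦x = surjective (x , Px) in ∈-resp X (i↦x ≡.refl) (∈-tabulate⁺ setoid i))
    , length-tabulate (proj₁ ∘ to)
    where
    open Bijection ∣P∣≡n using (to; injective; surjective)
    X : FinSet
    X = finSet (tabulate (proj₁ ∘ to)) (Uniqueₚ.tabulate⁺ setoid injective)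

  cardinality : ∀ X {P : Pred Carrier α} → (∀ {x} → x ∈ X → P x) → (∀ {x} → P x → x ∈ X) → ∣ P ∣≡ (# X)
  cardinality X X⊆P P⊆X = record
    { to        = λ i → lookup (list X) i , X⊆P (∈-lookup setoid (list X) i)
    ; cong      = λ { ≡.refl → refl }
    ; bijective = (λ {i} {j} → lookup-injective (unique X) i j)
                , λ (x , Px) → index (P⊆X Px) , λ { ≡.refl → sym (lookup-index (P⊆X Px)) }
    }


-- Passage to predicates and integer inequalities.

open import Data.Integer.Base using (+_; -_; _+_; _-_; _*_; _≤_; _>_; +<+)
import Data.Integer.Properties as ℤₚ
open import Relation.Unary using (_∈_; _⊆_; _≐_; _∖_; _⟨×⟩_)

m+2≤2n : ∀ m n → + m ≤ + 2 * + n - + 2 → m ℕ.+ 2 ℕ.≤ n ℕ.+ n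
m+2≤2n m n m≤ = ℤₚ.drop‿+≤+ (begin
  + m + + 2                   ≤⟨ ℤₚ.+-monoˡ-≤ (+ 2) m≤ ⟩
  + 2 * + n - + 2 + + 2       ≡⟨ ℤₚ.+-assoc (+ 2 * + n) (- + 2) (+ 2) ⟩
  + 2 * + n + + 0             ≡⟨ ℤₚ.+-identityʳ (+ 2 * + n) ⟩
  + 2 * + n                   ≡⟨ ℤₚ.pos-* 2 n ⟨
  + (2 ℕ.* n)                 ≡⟨ ≡.cong +_ (lemma n) ⟩
  + (n ℕ.+ n)                 ∎)
  where
  open ℤₚ.≤-Reasoning
  lemma : ∀ n → 2 ℕ.* n ≡ n ℕ.+ n
  lemma = solve-∀

k>2s-2h : ∀ k s h → s ℕ.+ s ℕ.< k ℕ.+ (h ℕ.+ h) → + k > + s + + s - + 2 * + h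
k>2s-2h k s h 2s<k+2h = begin-strict
  + (s ℕ.+ s) - + 2 * + h                  ≡⟨ ≡.cong (λ x → + (s ℕ.+ s) - x) 2h≡ ⟩
  + (s ℕ.+ s) - + (h ℕ.+ h)                <⟨ ℤₚ.+-monoˡ-< (- + (h ℕ.+ h)) (+<+ 2s<k+2h) ⟩
  + k + + (h ℕ.+ h) - + (h ℕ.+ h)          ≡⟨ ℤₚ.+-assoc (+ k) (+ (h ℕ.+ h)) (- + (h ℕ.+ h)) ⟩
  + k + (+ (h ℕ.+ h) - + (h ℕ.+ h))        ≡⟨ ≡.cong (λ x → + k + x) (ℤₚ.+-inverseʳ (+ (h ℕ.+ h))) ⟩
  + k + + 0                                ≡⟨ ℤₚ.+-identityʳ (+ k) ⟩
  + k                                      ∎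
  where
  open ℤₚ.≤-Reasoning
  lemma : ∀ h → 2 ℕ.* h ≡ h ℕ.+ h
  lemma = solve-∀
  2h≡ : + 2 * + h ≡ + (h ℕ.+ h)
  2h≡ = ≡.trans (≡.sym (ℤₚ.pos-* 2 h)) (≡.cong +_ (lemma h))

corollary3p2 :
    ∀ {c ℓ p : Level} → ExcludedMiddle (c ⊔ ℓ ⊔ p) →
    (G₀ : Group c ℓ) →
    let open Group G₀ hiding (_-_)
        open Subsets G₀
    in
    (A : Pred Carrier p) → A Respects _≈_ →
    (n m : ℕ) → ∣ A ∣≡ n → ∣ A ⁻¹ˢ · A ∣≡ m →
    let G = ⟨ A ⁻¹ˢ · A ⟩ in
    + m ≤ + 2 * + n - + 2 →
    ¬ (A ⁻¹ˢ · A ≐ G) →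
    ∃[ a ] (a ∈ A × (∃[ H ] (
      IsSubgroup {p = c ⊔ ℓ ⊔ p} H × H ⊆ G × ¬ (H ≐ ⟦ ε ⟧) ×
      ( ( (∀ x y → (x , y) ∈ (A ⟨×⟩ A) ∖ ((H · ⟦ a ⟧) ⟨×⟩ (H · ⟦ a ⟧)) →
             ⟦ x ⁻¹ ⟧ · H · ⟦ y ⟧ ⊆ A ⁻¹ˢ · A)
        × (∃[ s ] ∃[ t ] ∃[ h ] (
             ∣ A ⁻¹ˢ · H ∣≡ s × ∣ H · A ∣≡ t × ∣ H ∣≡ h ×
             + m > + s + + t - + 2 * + h)))
      ⊎ ( (∀ x y → (x , y) ∈ (A ⟨×⟩ A) ∖ ((⟦ a ⟧ · H) ⟨×⟩ (⟦ a ⟧ · H)) →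
             ⟦ x ⟧ · H · ⟦ y ⁻¹ ⟧ ⊆ A · A ⁻¹ˢ)
        × (∃[ k ] ∃[ s ] ∃[ h ] (
             ∣ A · A ⁻¹ˢ ∣≡ k × ∣ A · H ∣≡ s × ∣ H ∣≡ h ×
             + k > + s + + s - + 2 * + h)))))))
corollary3p2 {c} {ℓ} {p} em G₀ A A-resp n m ∣A∣≡n ∣A⁻¹A∣≡m m≤2n-2 _ =
  a , 𝓐⊆A a∈A , H , H-subgroup , H⊆G , H≢ε ,
  inj₂ (xHy⁻¹⊆ , # (𝓐 ⊙ A⁻¹) , # (𝓐 ⊙ 𝓗) , # 𝓗 ,
        cardinality (𝓐 ⊙ A⁻¹) 𝓐A⁻¹⊆ ⊆𝓐A⁻¹ , cardinality (𝓐 ⊙ 𝓗) 𝓐𝓗⊆ ⊆𝓐𝓗 , cardinality 𝓗 lift lower ,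
        k>2s-2h (# (𝓐 ⊙ A⁻¹)) (# (𝓐 ⊙ 𝓗)) (# 𝓗) 2#AH<)
  where
  open Group G₀ hiding (_-_)
  open Subsets G₀
  open FiniteSubsets G₀ (lowerEM {c ⊔ ℓ} {p} em)
    using (FinSet; #_; Inhabited; 1≤⇒inhabited; ∈-resp; _⊙_; ⊙⁺; ⊙⁻; QuotientSet; cancelˡ⁻¹;
           enumerate; cardinality; module Fragments; module SmallQuotientAtom)
    renaming (_∈_ to _∈ᶠ_)

  product-resp : ∀ {u v} {X : Pred Carrier u} {Y : Pred Carrier v} → (X · Y) Respects _≈_
  product-resp g≈h (x , y , x∈ , y∈ , g≈xy) = x , y , x∈ , y∈ , trans (sym g≈h) g≈xy

  A-enumeration : Σ[ X ∈ FinSet ] (∀ {x} → x ∈ᶠ X → A x) × (∀ {x} → A x → x ∈ᶠ X) × # X ≡ n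
  A-enumeration = enumerate A-resp ∣A∣≡n

  Q-enumeration : Σ[ X ∈ FinSet ] (∀ {x} → x ∈ᶠ X → (A ⁻¹ˢ · A) x) × (∀ {x} → (A ⁻¹ˢ · A) x → x ∈ᶠ X) × # X ≡ m
  Q-enumeration = enumerate product-resp ∣A⁻¹A∣≡m

  𝓐 𝓠 : FinSet
  𝓐 = proj₁ A-enumeration
  𝓠 = proj₁ Q-enumeration

  𝓐⊆A : ∀ {x} → x ∈ᶠ 𝓐 → A x
  𝓐⊆A = proj₁ (proj₂ A-enumeration)

  A⊆𝓐 : ∀ {x} → A x → x ∈ᶠ 𝓐
  A⊆𝓐 = proj₁ (proj₂ (proj₂ A-enumeration))

  A⁻¹A : QuotientSet 𝓐 𝓠
  A⁻¹A = record
    { A⁻¹A⊆Q = λ a∈ b∈ → proj₁ (proj₂ (proj₂ Q-enumeration)) (_ , _ , (_ , 𝓐⊆A a∈ , refl) , 𝓐⊆A b∈ , refl)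
    ; Q⊆A⁻¹A = λ x∈ → let _ , b , (a , a∈ , u≈a⁻¹) , b∈ , x≈ub = proj₁ (proj₂ Q-enumeration) x∈ in
        a , b , A⊆𝓐 a∈ , A⊆𝓐 b∈ , trans x≈ub (∙-congʳ u≈a⁻¹)
    }

  #𝓠+2≤ : # 𝓠 ℕ.+ 2 ℕ.≤ # 𝓐 ℕ.+ # 𝓐
  #𝓠+2≤ = ≡.subst₂ (λ m n → m ℕ.+ 2 ℕ.≤ n ℕ.+ n) (≡.sym (proj₂ (proj₂ (proj₂ Q-enumeration))))
                   (≡.sym (proj₂ (proj₂ (proj₂ A-enumeration)))) (m+2≤2n m n m≤2n-2)

  -- An empty `A` would violate |A⁻¹A| + 2 ≤ 2|A|.
  𝓐≠∅ : Inhabited 𝓐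
  𝓐≠∅ = 1≤⇒inhabited 𝓐 (ℕₚ.≮⇒≥ λ #𝓐<1 → impossible (# 𝓠 ℕ.+ 1) (#𝓠+2≤ ⊕ #𝓐<1 ⊕ #𝓐<1) (lemma (# 𝓐) (# 𝓠)))
    where
    lemma : ∀ a q → 1 ℕ.+ (a ℕ.+ a ℕ.+ (1 ℕ.+ 1)) ℕ.+ (q ℕ.+ 1) ≡ q ℕ.+ 2 ℕ.+ (suc a ℕ.+ suc a)
    lemma = solve-∀

  -- The subgroup `G` again, generated from the enumeration of A⁻¹A so that its universe level does
  -- not involve `p`.
  Γ : Pred Carrier (c ⊔ ℓ)
  Γ = ⟨ (_∈ᶠ 𝓠) ⟩

  Γ-subgroup : IsSubgroup Γ
  Γ-subgroup = record { resp-≈ = resp ; ε-closed = unit ; ∙-closed = mul ; ⁻¹-closed = inv }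

  Γ⊆G : ∀ {x} → Γ x → ⟨ A ⁻¹ˢ · A ⟩ x
  Γ⊆G (gen x∈)     = gen (proj₁ (proj₂ Q-enumeration) x∈)
  Γ⊆G (resp x≈y x) = resp x≈y (Γ⊆G x)
  Γ⊆G unit         = unit
  Γ⊆G (mul x y)    = mul (Γ⊆G x) (Γ⊆G y)
  Γ⊆G (inv x)      = inv (Γ⊆G x)

  open SmallQuotientAtom A⁻¹A 𝓐≠∅ #𝓠+2≤ Γ Γ-subgroup gen (Fragments.atom 𝓐 𝓐≠∅ Γ Γ-subgroup)
    using (a; a∈A; A⁻¹; A⁻¹⁺; A⁻¹⁻; ε∈H; HH⊆H; H⁻¹⊆H; H⊆Γ; H-nontrivial; 2#AH<; xHy⁻¹⊆AA⁻¹)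
    renaming (H to 𝓗)

  H : Pred Carrier (c ⊔ ℓ ⊔ p)
  H x = Lift p (x ∈ᶠ 𝓗)

  H-subgroup : IsSubgroup H
  H-subgroup = record
    { resp-≈    = λ x≈y (lift x∈) → lift (∈-resp 𝓗 x≈y x∈)
    ; ε-closed  = lift ε∈H
    ; ∙-closed  = λ (lift x∈) (lift y∈) → lift (HH⊆H x∈ y∈)
    ; ⁻¹-closed = λ (lift x∈) → lift (H⁻¹⊆H x∈)
    }

  H⊆G : H ⊆ ⟨ A ⁻¹ˢ · A ⟩
  H⊆G (lift x∈) = Γ⊆G (H⊆Γ x∈)

  H≢ε : ¬ (H ≐ ⟦ ε ⟧)
  H≢ε (H⊆ε , _) = H-nontrivial (λ x∈ → H⊆ε (lift x∈))

  in-coset : ∀ {x} → a ⁻¹ ∙ x ∈ᶠ 𝓗 → (⟦ a ⟧ · H) x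
  in-coset {x} x∈ = a , a ⁻¹ ∙ x , refl , lift x∈ , sym (cancelˡ⁻¹ a x)

  xHy⁻¹⊆ : ∀ x y → (x , y) ∈ (A ⟨×⟩ A) ∖ ((⟦ a ⟧ · H) ⟨×⟩ (⟦ a ⟧ · H)) →
           ⟦ x ⟧ · H · ⟦ y ⁻¹ ⟧ ⊆ A · A ⁻¹ˢ
  xHy⁻¹⊆ x y ((x∈A , y∈A) , not-both) (_ , _ , (_ , h , x′≈x , lift h∈ , u≈x′h) , v≈y⁻¹ , g≈uv) =
    let u , v , u∈ , v∈ , eq = xHy⁻¹⊆AA⁻¹ (A⊆𝓐 x∈A) (A⊆𝓐 y∈A)
                                 (λ (x∈aH , y∈aH) → not-both (in-coset x∈aH , in-coset y∈aH)) h∈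
    in u , v ⁻¹ , 𝓐⊆A u∈ , (v , 𝓐⊆A v∈ , refl) ,
       trans g≈uv (trans (∙-cong (trans u≈x′h (∙-congʳ x′≈x)) v≈y⁻¹) eq)

  𝓐A⁻¹⊆ : ∀ {x} → x ∈ᶠ 𝓐 ⊙ A⁻¹ → (A · A ⁻¹ˢ) x
  𝓐A⁻¹⊆ x∈ = let a , y , a∈ , y∈ , x≈ = ⊙⁻ 𝓐 A⁻¹ x∈ ; b , b∈ , y≈ = A⁻¹⁻ y∈ in
    a , y , 𝓐⊆A a∈ , (b , 𝓐⊆A b∈ , y≈) , x≈

  ⊆𝓐A⁻¹ : ∀ {x} → (A · A ⁻¹ˢ) x → x ∈ᶠ 𝓐 ⊙ A⁻¹
  ⊆𝓐A⁻¹ (_ , _ , a∈ , (_ , b∈ , y≈b⁻¹) , x≈) =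
    ∈-resp (𝓐 ⊙ A⁻¹) (sym (trans x≈ (∙-congˡ y≈b⁻¹))) (⊙⁺ 𝓐 A⁻¹ (A⊆𝓐 a∈) (A⁻¹⁺ (A⊆𝓐 b∈)))

  𝓐𝓗⊆ : ∀ {x} → x ∈ᶠ 𝓐 ⊙ 𝓗 → (A · H) x
  𝓐𝓗⊆ x∈ = let a , h , a∈ , h∈ , x≈ = ⊙⁻ 𝓐 𝓗 x∈ in a , h , 𝓐⊆A a∈ , lift h∈ , x≈

  ⊆𝓐𝓗 : ∀ {x} → (A · H) x → x ∈ᶠ 𝓐 ⊙ 𝓗
  ⊆𝓐𝓗 (_ , _ , a∈ , lift h∈ , x≈) = ∈-resp (𝓐 ⊙ 𝓗) (sym x≈) (⊙⁺ 𝓐 𝓗 (A⊆𝓐 a∈) h∈)
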